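{- Let $p\geq 2$ and let $\alpha\in\mathbb{N}$ (a positive integer) be fixed. Then there exists $N=N(\alpha,p)$, depending only on $p$ and $\alpha$, such that for all $n\geq N$, writing $k=n-\alpha$, \[ A(p,n,k)^2\geq A(p,n,k-1)\,A(p,n,k+1). \]
   Context: For $n\in\mathbb{N}$ let $S_n$ be the symmetric group on $[n]=\{1,\dots,n\}$. For $p,n\in\mathbb{N}$ let $\mathcal{C}_{p,n}=\{(\sigma_1,\dots,\sigma_p)\in (S_n)^p:\ \sigma_i\sigma_j=\sigma_j\sigma_i \text{ for all } i,j\in[p]\}$ be the set of commuting $p$-tuples of permutations of $[n]$. For $\boldsymbol\sigma\in\mathcal{C}_{p,n}$, let $\langle\boldsymbol\sigma\rangle$ be the subgroup of $S_n$ generated by $\sigma_1,\dots,\sigma_p$. For $1\le k\le n$, $A(p,n,k)$ denotes the number of $\boldsymbol\sigma\in\mathcal{C}_{p,n}$ such that the action of $\langle\boldsymbol\sigma\rangle$ on $[n]$ has exactly $k$ orbits. -}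

module Defs where

open import Data.Nat using (ℕ; _+_; _∸_)
open import Data.Fin using (Fin)
open import Data.Vec using (Vec; lookup)
open import Data.List using (List; length)
open import Data.List.Membership.Propositional using (_∈_)
open import Data.List.Relation.Unary.Unique.Propositional using (Unique)
open import Data.Product using (Σ; ∃; _×_)
open import Function.Bundles using (_⇔_)
open import Function.Definitions using (Injective)
open import Relation.Binary.PropositionalEquality using (_≡_)

-- A map [n] → [n] is represented by its table of values (a vector), so that
-- equality of maps is (extensional) propositional equality.
Map : ℕ → Set
Map n = Vec (Fin n) n

app : ∀ {n} → Map n → Fin n → Fin n
app f i = lookup f i

-- f is a permutation of [n] (injective self-map of a finite set, i.e. bijective)
IsPerm : ∀ {n} → Map n → Set
IsPerm f = Injective _≡_ _≡_ (app f)

Tuple : ℕ → ℕ → Set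
Tuple p n = Vec (Map n) p

IsCommutingTuple : ∀ {p n} → Tuple p n → Set
IsCommutingTuple {p} {n} σ =
  (∀ (i : Fin p) → IsPerm (lookup σ i)) ×
  (∀ (i j : Fin p) (x : Fin n) →
     app (lookup σ i) (app (lookup σ j) x) ≡ app (lookup σ j) (app (lookup σ i) x))

-- Orbit relation of ⟨σ⟩ acting on [n]: y = g x for g a word in the
-- generators σᵢ and their inverses.
data SameOrbit {p n} (σ : Tuple p n) (x : Fin n) : Fin n → Set where
  here : SameOrbit σ x x
  fwd  : ∀ {y} (i : Fin p) → SameOrbit σ x y → SameOrbit σ x (app (lookup σ i) y)
  bwd  : ∀ {y z} (i : Fin p) → SameOrbit σ x y → app (lookup σ i) z ≡ y → SameOrbit σ x z

-- The action of ⟨σ⟩ on [n] has exactly k orbits: there is a system of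
-- k representatives r : Fin k → [n] lying in pairwise distinct orbits and
-- meeting every orbit (i.e. Fin k is in bijection with the orbit set).
HasOrbits : ∀ {p n} → Tuple p n → ℕ → Set
HasOrbits {p} {n} σ k =
  Σ (Fin k → Fin n) λ r →
    (∀ a b → SameOrbit σ (r a) (r b) → a ≡ b) ×
    (∀ x → ∃ λ a → SameOrbit σ (r a) x)

InA : (p n k : ℕ) → Tuple p n → Set
InA p n k σ = IsCommutingTuple {p} {n} σ × HasOrbits σ k

-- "A(p,n,k) = a": the set {σ ∈ 𝒞_{p,n} : ⟨σ⟩ has exactly k orbits} has
-- exactly a elements, witnessed by a duplicate-free list enumerating it.
A≡ : ℕ → ℕ → ℕ → ℕ → Set
A≡ p n k a =
  Σ (List (Tuple p n)) λ L →
    Unique L × (∀ σ → (σ ∈ L) ⇔ InA p n k σ) × (length L ≡ a)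

{-# OPTIONS --safe #-}
module Submission where

-- A tuple with n − m orbits moves at most 2m points, with equality only if all
-- its nontrivial orbits have two elements. Consider pairs (σ, ρ) of tuples with
-- n − α − 1 and n − α + 1 orbits; together they move at most 4α points. If they
-- move exactly 4α points, then their supports are disjoint, and for each of the
-- 2(α + 1) points x moved by σ the two-element orbit of x can be cut out of σ
-- and glued into ρ. This gives two tuples with n − α orbits, and together with
-- x, one of the at most 2α points moved by the second, they determine (σ, ρ).
-- So there are at most α/(α + 1) A(p,n,n−α)² such pairs. The other pairs are
-- O(n^(4α−1)) in number, whereas A(p,n,n−α) is at least of order n^(2α) because
-- of products of α disjoint transpositions; for large n they are thus at most
-- A(p,n,n−α)²/(α + 1).

open import Defs
open import Data.Nat using (ℕ; zero; suc; _+_; _∸_; _*_; _^_; _≤_; _<_; z≤n; s≤s; s≤s⁻¹)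
open import Data.Nat.Properties hiding (_≟_)
open import Data.Nat.DivMod using (_/_; _%_; m≡m%n+[m/n]*n; m%n<n; m/n*n≤m; /-monoˡ-≤; m*n/n≡m)
open import Data.Bool using (if_then_else_)
open import Data.Fin using (Fin; zero; suc; toℕ; fromℕ<)
open import Data.Fin.Properties using (_≟_; all?; ¬∀⟶∃¬; toℕ-fromℕ<; toℕ-injective; toℕ<n)
open import Data.Fin.Permutation.Components using (transpose; transpose-inverse)
open import Data.Vec using (Vec; []; _∷_; lookup; tabulate; replicate; _[_]≔_)
import Data.Vec as Vec
open import Data.Vec.Properties using (lookup∘tabulate; tabulate∘lookup; tabulate-cong; lookup-replicate; lookup∘update; lookup∘update′; []≔-idempotent; []≔-lookup; length-toList)
open import Data.List using (List; []; _∷_; _++_; length; map; filter; allFin; cartesianProduct; cartesianProductWith)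
import Data.List as List
open import Data.List.Properties using (length-map; length-++; length-tabulate)
open import Data.List.Membership.Propositional using (_∈_; _∉_)
open import Data.List.Membership.Propositional.Properties
open import Data.List.Relation.Unary.Any using (here; there; index)
open import Data.List.Relation.Unary.Any.Properties using (lookup-index)
import Data.List.Relation.Unary.All as All
open import Data.List.Relation.Unary.AllPairs using ([]; _∷_)
open import Data.List.Relation.Unary.Unique.Propositional using (Unique)
import Data.List.Relation.Unary.Unique.Propositional.Properties as Uniq
open import Data.Product using (∃; _×_; _,_; proj₁; proj₂)
open import Data.Product.Properties using (,-injectiveˡ; ,-injectiveʳ)
open import Data.Sum using (_⊎_; inj₁; inj₂; [_,_]′)
open import Level using (0ℓ)
open import Function using (_∘_; id; const)
open import Function.Bundles using (_⇔_; Equivalence)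
open import Relation.Nullary using (¬_; yes; no; does; contradiction)
open import Relation.Nullary.Decidable using (dec-true; dec-false; ¬?; _⊎-dec_; _×-dec_; decidable-stable)
open import Relation.Unary using (Pred; Decidable; ∁)
open import Relation.Binary.PropositionalEquality using (_≡_; _≢_; refl; sym; trans; cong; cong₂; subst; subst₂; module ≡-Reasoning)

-- Counting with duplicate-free lists

module _ {A : Set} where

  unique-⊆⇒length-≤ : ∀ {xs ys : List A} → Unique xs → (∀ {z} → z ∈ xs → z ∈ ys) → length xs ≤ length ys
  unique-⊆⇒length-≤ {[]} _ _ = z≤n
  unique-⊆⇒length-≤ {x ∷ xs} {ys} u@(_ ∷ u′) sub with ∈-∃++ (sub (here refl))
  ... | as , bs , refl = begin
      suc (length xs)               ≤⟨ s≤s (unique-⊆⇒length-≤ u′ sub′) ⟩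
      suc (length (as ++ bs))       ≡⟨ cong suc (length-++ as) ⟩
      suc (length as + length bs)   ≡⟨ +-suc (length as) (length bs) ⟨
      length as + length (x ∷ bs)   ≡⟨ length-++ as ⟨
      length (as ++ x ∷ bs)         ∎
    where
    open ≤-Reasoning
    sub′ : ∀ {z} → z ∈ xs → z ∈ as ++ bs
    sub′ z∈xs with ∈-++⁻ as (sub (there z∈xs))
    ... | inj₁ z∈as         = ∈-++⁺ˡ z∈as
    ... | inj₂ (here refl)  = contradiction z∈xs (Uniq.Unique[x∷xs]⇒x∉xs u)
    ... | inj₂ (there z∈bs) = ∈-++⁺ʳ as z∈bs

  unique-⇔⇒length-≡ : ∀ {xs ys : List A} → Unique xs → Unique ys →
    (∀ {z} → z ∈ xs → z ∈ ys) → (∀ {z} → z ∈ ys → z ∈ xs) → length xs ≡ length ys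
  unique-⇔⇒length-≡ u v f g = ≤-antisym (unique-⊆⇒length-≤ u f) (unique-⊆⇒length-≤ v g)

  unique⇒lookup-injective : ∀ {xs : List A} → Unique xs →
    ∀ i j → List.lookup xs i ≡ List.lookup xs j → i ≡ j
  unique⇒lookup-injective (_ ∷ _) zero zero _ = refl
  unique⇒lookup-injective u@(_ ∷ _) zero (suc j) eq =
    contradiction (subst (_∈ _) (sym eq) (∈-lookup j)) (Uniq.Unique[x∷xs]⇒x∉xs u)
  unique⇒lookup-injective u@(_ ∷ _) (suc i) zero eq =
    contradiction (subst (_∈ _) eq (∈-lookup i)) (Uniq.Unique[x∷xs]⇒x∉xs u)
  unique⇒lookup-injective (_ ∷ u) (suc i) (suc j) eq = cong suc (unique⇒lookup-injective u i j eq)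

module _ {A B : Set} where

  InjectiveOn : List A → (A → B) → Set
  InjectiveOn xs f = ∀ {x y} → x ∈ xs → y ∈ xs → f x ≡ f y → x ≡ y

  unique-map : ∀ {xs} (f : A → B) → InjectiveOn xs f → Unique xs → Unique (map f xs)
  unique-map {[]} f inj u = []
  unique-map {x ∷ xs} f inj u@(_ ∷ u′) =
    All.tabulate fresh ∷ unique-map f (λ p q → inj (there p) (there q)) u′
    where
    fresh : ∀ {w} → w ∈ map f xs → f x ≢ w
    fresh w∈ eq with ∈-map⁻ f w∈
    ... | y , y∈xs , refl =
      Uniq.Unique[x∷xs]⇒x∉xs u (subst (_∈ xs) (sym (inj (here refl) (there y∈xs) eq)) y∈xs)

  injection⇒length-≤ : ∀ {xs ys} (f : A → B) → Unique xs → InjectiveOn xs f →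
    (∀ {x} → x ∈ xs → f x ∈ ys) → length xs ≤ length ys
  injection⇒length-≤ {xs} {ys} f u inj into =
    subst (_≤ length ys) (length-map f xs) (unique-⊆⇒length-≤ (unique-map f inj u) sub)
    where
    sub : ∀ {z} → z ∈ map f xs → z ∈ ys
    sub z∈ with ∈-map⁻ f z∈
    ... | x , x∈xs , refl = into x∈xs

  -- A dependent product of lists; bounds on its fibres bound its length, which is the form that
  -- double counting takes below.
  fibred : (A → List B) → List A → List (A × B)
  fibred f []       = []
  fibred f (a ∷ as) = map (a ,_) (f a) ++ fibred f as

  ∈-fibred⁺ : ∀ f {as a b} → a ∈ as → b ∈ f a → (a , b) ∈ fibred f as
  ∈-fibred⁺ f (here refl) q = ∈-++⁺ˡ (∈-map⁺ _ q)
  ∈-fibred⁺ f (there {x} p) q = ∈-++⁺ʳ (map (x ,_) (f x)) (∈-fibred⁺ f p q)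

  ∈-fibred⁻ : ∀ f as {a b} → (a , b) ∈ fibred f as → a ∈ as × b ∈ f a
  ∈-fibred⁻ f (x ∷ as) p with ∈-++⁻ (map (x ,_) (f x)) p
  ... | inj₂ q = let r , s = ∈-fibred⁻ f as q in there r , s
  ... | inj₁ q with ∈-map⁻ _ q
  ...   | _ , b∈ , refl = here refl , b∈

  unique-fibred : ∀ f {as} → Unique as → (∀ a → Unique (f a)) → Unique (fibred f as)
  unique-fibred f [] v = []
  unique-fibred f {a ∷ as} u@(_ ∷ u′) v =
    Uniq.++⁺ (Uniq.map⁺ ,-injectiveʳ (v a)) (unique-fibred f u′ v) disjoint
    where
    disjoint : ∀ {z} → ¬ (z ∈ map (a ,_) (f a) × z ∈ fibred f as)
    disjoint (p , q) with ∈-map⁻ _ p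
    ... | _ , _ , refl = Uniq.Unique[x∷xs]⇒x∉xs u (proj₁ (∈-fibred⁻ f as q))

  length-fibred-≥ : ∀ f as k → (∀ {a} → a ∈ as → k ≤ length (f a)) → length as * k ≤ length (fibred f as)
  length-fibred-≥ f [] k h = z≤n
  length-fibred-≥ f (a ∷ as) k h = begin
      k + length as * k                             ≤⟨ +-mono-≤ (h (here refl)) (length-fibred-≥ f as k (h ∘ there)) ⟩
      length (f a) + length (fibred f as)           ≡⟨ cong (_+ _) (length-map (a ,_) (f a)) ⟨
      length (map (a ,_) (f a)) + length (fibred f as) ≡⟨ length-++ (map (a ,_) (f a)) ⟨
      length (fibred f (a ∷ as))                    ∎
    where open ≤-Reasoning

  length-fibred-≤ : ∀ f as k → (∀ {a} → a ∈ as → length (f a) ≤ k) → length (fibred f as) ≤ length as * k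
  length-fibred-≤ f [] k h = z≤n
  length-fibred-≤ f (a ∷ as) k h = begin
      length (fibred f (a ∷ as))                    ≡⟨ length-++ (map (a ,_) (f a)) ⟩
      length (map (a ,_) (f a)) + length (fibred f as) ≡⟨ cong (_+ _) (length-map (a ,_) (f a)) ⟩
      length (f a) + length (fibred f as)           ≤⟨ +-mono-≤ (h (here refl)) (length-fibred-≤ f as k (h ∘ there)) ⟩
      k + length as * k                             ∎
    where open ≤-Reasoning

length-cartesianProductWith : ∀ {A B C : Set} (f : A → B → C) xs ys →
  length (cartesianProductWith f xs ys) ≡ length xs * length ys
length-cartesianProductWith f [] ys = refl
length-cartesianProductWith f (x ∷ xs) ys =
  trans (length-++ (map (f x) ys)) (cong₂ _+_ (length-map (f x) ys) (length-cartesianProductWith f xs ys))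

unique-⊆-++ : ∀ {A : Set} {xs ys zs : List A} → Unique xs →
  (∀ {x} → x ∈ xs → x ∈ ys ⊎ x ∈ zs) → length xs ≤ length ys + length zs
unique-⊆-++ {ys = ys} u h =
  subst (_ ≤_) (length-++ ys) (unique-⊆⇒length-≤ u ([ ∈-++⁺ˡ , ∈-++⁺ʳ ys ]′ ∘ h))

length-allFin : ∀ n → length (allFin n) ≡ n
length-allFin n = length-tabulate id

-- Subsets of `Fin n` as lists

subset : ∀ {n} {P : Pred (Fin n) 0ℓ} → Decidable P → List (Fin n)
subset P? = filter P? (allFin _)

module _ {n : ℕ} {P : Pred (Fin n) 0ℓ} (P? : Decidable P) where

  unique-subset : Unique (subset P?)
  unique-subset = Uniq.filter⁺ P? (Uniq.allFin⁺ n)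

  ∈-subset⁺ : ∀ {z} → P z → z ∈ subset P?
  ∈-subset⁺ = ∈-filter⁺ P? (∈-allFin _)

  ∈-subset⁻ : ∀ {z} → z ∈ subset P? → P z
  ∈-subset⁻ {z} = proj₂ ∘ ∈-filter⁻ P? {z} {allFin n}

complementary⇒length : ∀ {n} {xs ys : List (Fin n)} → Unique xs → Unique ys →
  (∀ {z} → z ∈ xs → z ∉ ys) → (∀ z → z ∈ xs ⊎ z ∈ ys) → length xs + length ys ≡ n
complementary⇒length {n} {xs} {ys} u v d c = begin
    length xs + length ys ≡⟨ length-++ xs ⟨
    length (xs ++ ys)     ≡⟨ unique-⇔⇒length-≡ (Uniq.++⁺ u v (λ (p , q) → d p q)) (Uniq.allFin⁺ n)
                               (λ _ → ∈-allFin _) (λ {z} _ → [ ∈-++⁺ˡ , ∈-++⁺ʳ xs ]′ (c z)) ⟩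
    length (allFin n)     ≡⟨ length-allFin n ⟩
    n                     ∎
  where open ≡-Reasoning

without : ∀ {n} → Fin n → List (Fin n) → List (Fin n)
without w = filter (λ z → ¬? (z ≟ w))

module _ {n : ℕ} (w : Fin n) {xs : List (Fin n)} where

  ∈-without⁺ : ∀ {z} → z ∈ xs → z ≢ w → z ∈ without w xs
  ∈-without⁺ = ∈-filter⁺ (λ z → ¬? (z ≟ w))

  ∈-without⁻ : ∀ {z} → z ∈ without w xs → z ∈ xs × z ≢ w
  ∈-without⁻ = ∈-filter⁻ (λ z → ¬? (z ≟ w))

  unique-without : Unique xs → Unique (without w xs)
  unique-without = Uniq.filter⁺ (λ z → ¬? (z ≟ w))

  length-without : Unique xs → w ∈ xs → length xs ≡ suc (length (without w xs))
  length-without u w∈ = unique-⇔⇒length-≡ u (All.tabulate (λ p eq → proj₂ (∈-without⁻ p) (sym eq)) ∷ unique-without u) to from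
    where
    to : ∀ {z} → z ∈ xs → z ∈ w ∷ without w xs
    to {z} z∈ with z ≟ w
    ... | yes z≡w = here z≡w
    ... | no  z≢w = there (∈-without⁺ z∈ z≢w)
    from : ∀ {z} → z ∈ w ∷ without w xs → z ∈ xs
    from (here refl) = w∈
    from (there p)   = proj₁ (∈-without⁻ p)

-- Tuples of maps and their orbits

act : ∀ {p n} → Tuple p n → Fin p → Fin n → Fin n
act σ i z = app (lookup σ i) z

lookup-ext : ∀ {A : Set} {n} {u v : Vec A n} → (∀ i → lookup u i ≡ lookup v i) → u ≡ v
lookup-ext {u = u} {v} h = trans (sym (tabulate∘lookup u)) (trans (tabulate-cong h) (tabulate∘lookup v))

tuple-ext : ∀ {p n} {σ τ : Tuple p n} → (∀ i z → act σ i z ≡ act τ i z) → σ ≡ τ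
tuple-ext h = lookup-ext (λ i → lookup-ext (h i))

idTuple : ∀ {p n} → Tuple p n
idTuple = replicate _ (Vec.allFin _)

act-idTuple : ∀ {p n} i z → act (idTuple {p} {n}) i z ≡ z
act-idTuple i z = trans (cong (λ f → app f z) (lookup-replicate i _)) (lookup∘tabulate id z)

idTuple-commuting : ∀ {p n} → IsCommutingTuple (idTuple {p} {n})
idTuple-commuting =
  (λ i {x} {y} eq → trans (sym (act-idTuple i x)) (trans eq (act-idTuple i y))) ,
  (λ i j x → trans (act-idTuple i _) (trans (act-idTuple j x)
    (sym (trans (act-idTuple j _) (act-idTuple i x)))))

FixedBy : ∀ {p n} → Tuple p n → Fin n → Set
FixedBy σ z = ∀ i → act σ i z ≡ z

module _ {p n : ℕ} {σ : Tuple p n} where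

  SameOrbit-trans : ∀ {x y z} → SameOrbit σ x y → SameOrbit σ y z → SameOrbit σ x z
  SameOrbit-trans s here        = s
  SameOrbit-trans s (fwd i t)   = fwd i (SameOrbit-trans s t)
  SameOrbit-trans s (bwd i t e) = bwd i (SameOrbit-trans s t) e

  SameOrbit-sym : ∀ {x y} → SameOrbit σ x y → SameOrbit σ y x
  SameOrbit-sym here        = here
  SameOrbit-sym (fwd i t)   = SameOrbit-trans (bwd i here refl) (SameOrbit-sym t)
  SameOrbit-sym (bwd i t refl) = SameOrbit-trans (fwd i here) (SameOrbit-sym t)

  invariant-on-orbits : ∀ {A : Set} (f : Fin n → A) → (∀ i z → f (act σ i z) ≡ f z) →
    ∀ {x y} → SameOrbit σ x y → f x ≡ f y
  invariant-on-orbits f inv here           = refl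
  invariant-on-orbits f inv (fwd i t)      = trans (invariant-on-orbits f inv t) (sym (inv i _))
  invariant-on-orbits f inv (bwd i t refl) = trans (invariant-on-orbits f inv t) (inv i _)

  -- Follow the path backwards from `z`. If the last step takes `y` to a fixed point, injectivity
  -- identifies `y` with that point, so the path never leaves `z`.
  fixed-orbit : IsCommutingTuple σ → ∀ {x z} → FixedBy σ z → SameOrbit σ x z → x ≡ z
  fixed-orbit comm fz here = refl
  fixed-orbit comm@(perm , _) fz (fwd {y} i t) =
    trans (fixed-orbit comm (subst (FixedBy σ) σy≡y fz) t) (sym σy≡y)
    where
    σy≡y : act σ i y ≡ y
    σy≡y = perm i (fz i)
  fixed-orbit comm fz (bwd i t refl) =
    trans (fixed-orbit comm (subst (FixedBy σ) (sym (fz i)) fz) t) (fz i)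

-- Moved points and supports

partner : ∀ {p n} → Tuple p n → Fin n → Fin n
-- This default makes `partner σ x ≡ x` equivalent to `x` being fixed, so that being moved is
-- decidable.
partner []      x = x
partner (f ∷ σ) x = if does (app f x ≟ x) then partner σ x else app f x

-- The values at `x` alone determine its partner. Hence an orbit glued into another tuple can later
-- be located there from `x`.
partner-cong : ∀ {p n} (σ τ : Tuple p n) x → (∀ i → act σ i x ≡ act τ i x) → partner σ x ≡ partner τ x
partner-cong []      []      x h = refl
partner-cong (f ∷ σ) (g ∷ τ) x h rewrite h zero | partner-cong σ τ x (h ∘ suc) = refl

partner-fixed : ∀ {p n} (σ : Tuple p n) x → partner σ x ≡ x → FixedBy σ x
partner-fixed (f ∷ σ) x eq with app f x ≟ x
... | no fx≢x = contradiction eq fx≢x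
... | yes fx≡x = λ { zero → fx≡x ; (suc i) → partner-fixed σ x eq i }

partner-image : ∀ {p n} (σ : Tuple p n) x → partner σ x ≢ x → ∃ λ i → partner σ x ≡ act σ i x
partner-image [] x ne = contradiction refl ne
partner-image (f ∷ σ) x ne with app f x ≟ x
... | no _ = zero , refl
... | yes _ = let i , eq = partner-image σ x ne in suc i , eq

fixed-partner : ∀ {p n} (σ : Tuple p n) x → FixedBy σ x → partner σ x ≡ x
fixed-partner [] x h = refl
fixed-partner (f ∷ σ) x h with app f x ≟ x
... | no fx≢x = contradiction (h zero) fx≢x
... | yes _ = fixed-partner σ x (h ∘ suc)

partner-orbit : ∀ {p n} (σ : Tuple p n) x → SameOrbit σ x (partner σ x)
partner-orbit σ x with partner σ x ≟ x
... | yes eq = subst (SameOrbit σ x) (sym eq) here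
... | no ne = let i , eq = partner-image σ x ne in subst (SameOrbit σ x) (sym eq) (fwd i here)

Moved : ∀ {p n} → Tuple p n → Fin n → Set
Moved σ z = partner σ z ≢ z

moved? : ∀ {p n} (σ : Tuple p n) → Decidable (Moved σ)
moved? σ z = ¬? (partner σ z ≟ z)

unmoved⇒fixed : ∀ {p n} (σ : Tuple p n) {z} → ¬ Moved σ z → FixedBy σ z
unmoved⇒fixed σ {z} h = partner-fixed σ z (decidable-stable (partner σ z ≟ z) h)

-- If the image of `z` were fixed, injectivity would identify it with `z`.
moved-image : ∀ {p n} (σ : Tuple p n) → IsCommutingTuple σ → ∀ i {z} → Moved σ z → Moved σ (act σ i z)
moved-image σ (perm , _) i {z} mz eq = mz (fixed-partner σ z (subst (FixedBy σ) σz≡z fixed))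
  where
  fixed : FixedBy σ (act σ i z)
  fixed = partner-fixed σ _ eq
  σz≡z : act σ i z ≡ z
  σz≡z = perm i (fixed i)

supp : ∀ {p n} → Tuple p n → List (Fin n)
supp σ = subset (moved? σ)

-- A system of orbit representatives, recorded through the retraction onto it;
-- having m non-representatives amounts to having n ∸ m orbits.
record Reps {p n} (σ : Tuple p n) (m : ℕ) : Set where
  field
    rep       : Fin n → Fin n
    rep-act   : ∀ i z → rep (act σ i z) ≡ rep z
    rep-orbit : ∀ z → SameOrbit σ (rep z) z
    others    : List (Fin n)
    unique    : Unique others
    others⁺   : ∀ {z} → rep z ≢ z → z ∈ others
    others⁻   : ∀ {z} → z ∈ others → rep z ≢ z
    size      : length others ≡ m

  rep-cong : ∀ {x y} → SameOrbit σ x y → rep x ≡ rep y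
  rep-cong = invariant-on-orbits rep rep-act

  rep-idem : ∀ z → rep (rep z) ≡ rep z
  rep-idem z = rep-cong (rep-orbit z)

  rep-fixed : IsCommutingTuple σ → ∀ {z} → FixedBy σ z → rep z ≡ z
  rep-fixed comm fz = fixed-orbit comm fz (rep-orbit _)

module _ {p n m : ℕ} {σ : Tuple p n} where

  -- The retraction sends a point to the chosen representative of its orbit. The `n ∸ m`
  -- representatives and the others partition `Fin n`, which leaves `m` others.
  HasOrbits⇒Reps : m ≤ n → HasOrbits σ (n ∸ m) → Reps σ m
  HasOrbits⇒Reps m≤n (r , r-inj , r-sur) = record
    { rep       = rep
    ; rep-act   = λ i z → cong r (cls-cong (SameOrbit-sym (fwd i here)))
    ; rep-orbit = λ z → proj₂ (r-sur z)
    ; others    = subset other?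
    ; unique    = unique-subset other?
    ; others⁺   = ∈-subset⁺ other?
    ; others⁻   = ∈-subset⁻ other?
    ; size      = +-cancelˡ-≡ (n ∸ m) _ _ (trans count (sym (m∸n+n≡m m≤n)))
    }
    where
    cls : Fin n → Fin (n ∸ m)
    cls z = proj₁ (r-sur z)
    cls-cong : ∀ {x y} → SameOrbit σ x y → cls x ≡ cls y
    cls-cong {x} {y} s = r-inj _ _
      (SameOrbit-trans (proj₂ (r-sur x)) (SameOrbit-trans s (SameOrbit-sym (proj₂ (r-sur y)))))
    rep : Fin n → Fin n
    rep = r ∘ cls
    cls-r : ∀ a → cls (r a) ≡ a
    cls-r a = r-inj _ _ (proj₂ (r-sur (r a)))
    other? : Decidable (λ z → rep z ≢ z)
    other? z = ¬? (rep z ≟ z)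
    disjoint : ∀ {z} → z ∈ map r (allFin (n ∸ m)) → z ∉ subset other?
    disjoint p q with ∈-map⁻ r p
    ... | a , _ , refl = ∈-subset⁻ other? q (cong r (cls-r a))
    cover : ∀ z → z ∈ map r (allFin (n ∸ m)) ⊎ z ∈ subset other?
    cover z with rep z ≟ z
    ... | yes eq = inj₁ (subst (_∈ _) eq (∈-map⁺ r (∈-allFin (cls z))))
    ... | no  ne = inj₂ (∈-subset⁺ other? ne)
    r-injective : ∀ {a b} → r a ≡ r b → a ≡ b
    r-injective {a} {b} eq = r-inj a b (subst (SameOrbit σ (r a)) eq here)
    count : (n ∸ m) + length (subset other?) ≡ n
    count = trans
      (cong (_+ length (subset other?)) (sym (trans (length-map r (allFin (n ∸ m))) (length-allFin (n ∸ m)))))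
      (complementary⇒length (Uniq.map⁺ r-injective (Uniq.allFin⁺ _)) (unique-subset other?) disjoint cover)

  -- The representatives are the fixed points of `rep`. As `rep` is constant on orbits, no orbit
  -- contains two of them.
  Reps⇒HasOrbits : Reps σ m → HasOrbits σ (n ∸ m)
  Reps⇒HasOrbits R = subst (HasOrbits σ) count (List.lookup reps , inj , sur)
    where
    open Reps R
    rep? : Decidable (λ z → rep z ≡ z)
    rep? z = rep z ≟ z
    reps : List (Fin n)
    reps = subset rep?
    inj : ∀ a b → SameOrbit σ (List.lookup reps a) (List.lookup reps b) → a ≡ b
    inj a b s = unique⇒lookup-injective (unique-subset rep?) a b
      (trans (sym (∈-subset⁻ rep? (∈-lookup a))) (trans (rep-cong s) (∈-subset⁻ rep? (∈-lookup b))))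
    sur : ∀ x → ∃ λ a → SameOrbit σ (List.lookup reps a) x
    sur x = index rx∈ , subst (λ z → SameOrbit σ z x) (lookup-index rx∈) (rep-orbit x)
      where
      rx∈ : rep x ∈ reps
      rx∈ = ∈-subset⁺ rep? (rep-idem x)
    cover : ∀ z → z ∈ reps ⊎ z ∈ others
    cover z with rep z ≟ z
    ... | yes eq = inj₁ (∈-subset⁺ rep? eq)
    ... | no  ne = inj₂ (others⁺ ne)
    count : length reps ≡ n ∸ m
    count = trans (sym (m+n∸n≡m (length reps) m)) (cong (_∸ m) (trans (cong (length reps +_) (sym size))
      (complementary⇒length (unique-subset rep?) unique (λ p q → others⁻ q (∈-subset⁻ rep? p)) cover)))

-- Splicing two tuples along a common invariant set

-- With both directions the complement is invariant as well, and forward and backward steps of an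
-- orbit path stay on one side.
Invariant : ∀ {p n} → Pred (Fin n) 0ℓ → Tuple p n → Set
Invariant P σ = ∀ i z → (P z → P (act σ i z)) × (P (act σ i z) → P z)

Invariant-∁ : ∀ {p n} {P : Pred (Fin n) 0ℓ} (σ : Tuple p n) → Invariant P σ → Invariant (∁ P) σ
Invariant-∁ σ inv i z = (_∘ proj₂ (inv i z)) , (_∘ proj₁ (inv i z))

-- A path that ends in an invariant set lies in it throughout, and there the two tuples act alike.
SameOrbit-transfer : ∀ {p n} {P : Pred (Fin n) 0ℓ} {σ τ : Tuple p n} → Invariant P σ →
  (∀ i {z} → P z → act τ i z ≡ act σ i z) → ∀ {x z} → P z → SameOrbit σ x z → SameOrbit τ x z
SameOrbit-transfer inv agree pz here = here
SameOrbit-transfer {τ = τ} inv agree {x} pz (fwd {y} i s) =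
  subst (SameOrbit τ x) (agree i py) (fwd i (SameOrbit-transfer inv agree py s))
  where py = proj₂ (inv i y) pz
SameOrbit-transfer inv agree {z = z} pz (bwd i s refl) =
  bwd i (SameOrbit-transfer inv agree (proj₁ (inv i z) pz) s) (agree i pz)

module _ {n : ℕ} {P : Pred (Fin n) 0ℓ} (P? : Decidable P) {A : Set} (f g : Fin n → A) where

  splice : Fin n → A
  splice z = if does (P? z) then f z else g z

  splice-in : ∀ {z} → P z → splice z ≡ f z
  splice-in {z} pz = cong (if_then f z else g z) (dec-true (P? z) pz)

  splice-out : ∀ {z} → ¬ P z → splice z ≡ g z
  splice-out {z} ¬pz = cong (if_then f z else g z) (dec-false (P? z) ¬pz)

module _ {p n : ℕ} {P : Pred (Fin n) 0ℓ} (P? : Decidable P) where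

  mix : Tuple p n → Tuple p n → Tuple p n
  mix σ τ = tabulate λ i → tabulate (splice P? (act σ i) (act τ i))

  module _ (σ τ : Tuple p n) where

    act-mix : ∀ i z → act (mix σ τ) i z ≡ splice P? (act σ i) (act τ i) z
    act-mix i z = trans (cong (λ f → app f z) (lookup∘tabulate _ i)) (lookup∘tabulate _ z)

    act-mix-in : ∀ i {z} → P z → act (mix σ τ) i z ≡ act σ i z
    act-mix-in i pz = trans (act-mix i _) (splice-in P? (act σ i) (act τ i) pz)

    act-mix-out : ∀ i {z} → ¬ P z → act (mix σ τ) i z ≡ act τ i z
    act-mix-out i ¬pz = trans (act-mix i _) (splice-out P? (act σ i) (act τ i) ¬pz)

    module _ (invσ : Invariant P σ) (invτ : Invariant P τ) where

      mix-invariant : Invariant P (mix σ τ)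
      mix-invariant i z with P? z
      ... | yes pz = subst (λ w → (P z → P w) × (P w → P z)) (sym (act-mix-in i pz)) (invσ i z)
      ... | no ¬pz = subst (λ w → (P z → P w) × (P w → P z)) (sym (act-mix-out i ¬pz)) (invτ i z)

      -- Both tuples preserve `P` and its complement, so a point meets only one of the two tuples
      -- however many maps are applied; points with equal images lie on the same side.
      mix-commuting : IsCommutingTuple σ → IsCommutingTuple τ → IsCommutingTuple (mix σ τ)
      mix-commuting (permσ , commσ) (permτ , commτ) = perm , comm
        where
        perm : ∀ i → IsPerm (lookup (mix σ τ) i)
        perm i {x} {y} eq with P? x
        ... | yes px = permσ i (trans (sym (act-mix-in i px)) (trans eq (act-mix-in i py)))
          where py = proj₂ (mix-invariant i y) (subst P eq (proj₁ (mix-invariant i x) px))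
        ... | no ¬px = permτ i (trans (sym (act-mix-out i ¬px)) (trans eq (act-mix-out i ¬py)))
          where ¬py = λ py → ¬px (proj₂ (mix-invariant i x) (subst P (sym eq) (proj₁ (mix-invariant i y) py)))
        two-in : ∀ i j {x} → P x → act (mix σ τ) i (act (mix σ τ) j x) ≡ act σ i (act σ j x)
        two-in i j px = trans (cong (act (mix σ τ) i) (act-mix-in j px)) (act-mix-in i (proj₁ (invσ j _) px))
        two-out : ∀ i j {x} → ¬ P x → act (mix σ τ) i (act (mix σ τ) j x) ≡ act τ i (act τ j x)
        two-out i j ¬px = trans (cong (act (mix σ τ) i) (act-mix-out j ¬px)) (act-mix-out i (¬px ∘ proj₂ (invτ j _)))
        comm : ∀ i j x → act (mix σ τ) i (act (mix σ τ) j x) ≡ act (mix σ τ) j (act (mix σ τ) i x)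
        comm i j x with P? x
        ... | yes px = trans (two-in i j px) (trans (commσ i j x) (sym (two-in j i px)))
        ... | no ¬px = trans (two-out i j ¬px) (trans (commτ i j x) (sym (two-out j i ¬px)))

Pair : ∀ {n} → Fin n → Fin n → Fin n → Set
Pair x y z = z ≡ x ⊎ z ≡ y

pair? : ∀ {n} (x y : Fin n) → Decidable (Pair x y)
pair? x y z = (z ≟ x) ⊎-dec (z ≟ y)

Invariant-fixed : ∀ {p n} (σ : Tuple p n) → IsCommutingTuple σ → ∀ {x y} →
  FixedBy σ x → FixedBy σ y → Invariant (Pair x y) σ
Invariant-fixed σ (perm , _) {x} {y} fx fy i z =
  (λ { (inj₁ refl) → inj₁ (fx i) ; (inj₂ refl) → inj₂ (fy i) }) ,
  (λ { (inj₁ e) → inj₁ (perm i (trans e (sym (fx i)))) ; (inj₂ e) → inj₂ (perm i (trans e (sym (fy i)))) })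

-- Adding and removing an orbit with two elements

module _ {p n : ℕ} {σ : Tuple p n} {x y : Fin n} (x≢y : x ≢ y) {m : ℕ} (R : Reps σ (suc m))
  (same : Reps.rep R y ≡ Reps.rep R x) (two : ∀ {z} → Reps.rep R z ≡ Reps.rep R x → Pair x y z) where
  open Reps R

  private
    rep-pair : ∀ {z} → Pair x y z → rep z ≡ rep x
    rep-pair (inj₁ refl) = refl
    rep-pair (inj₂ refl) = same

  -- By `same` and `two`, the points `x` and `y` make up a whole class of `rep`, and `rep` is
  -- constant on orbits.
  orbit-invariant : Invariant (Pair x y) σ
  orbit-invariant i z =
    (λ pz → two (trans (rep-act i z) (rep-pair pz))) ,
    (λ pz → two (trans (sym (rep-act i z)) (rep-pair pz)))

  private
    -- The retraction may have picked either point: `rep x` is one of them, and `w` is the other.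
    non-rep : ∃ λ w → Pair x y w × rep w ≢ w × (∀ {z} → Pair x y z → rep z ≢ z → z ≡ w)
    non-rep with two (rep-idem x)
    ... | inj₁ rx≡x = y , inj₂ refl , (λ ry≡y → x≢y (trans (sym rx≡x) (trans (sym same) ry≡y))) ,
      λ { (inj₁ refl) ne → contradiction rx≡x ne ; (inj₂ refl) _ → refl }
    ... | inj₂ rx≡y = x , inj₁ refl , (λ rx≡x → x≢y (trans (sym rx≡x) rx≡y)) ,
      λ { (inj₁ refl) _ → refl ; (inj₂ refl) ne → contradiction (trans same rx≡y) ne }

  -- Once `x` and `y` are fixed, both represent themselves. The other orbits are untouched, so
  -- exactly `w` ceases to be a non-representative.
  remove-orbit : Reps (mix (pair? x y) idTuple σ) m
  remove-orbit = record
    { rep       = rep′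
    ; rep-act   = rep′-act
    ; rep-orbit = rep′-orbit
    ; others    = without w others
    ; unique    = unique-without w unique
    ; others⁺   = others′⁺
    ; others⁻   = others′⁻
    ; size      = suc-injective (trans (sym (length-without w unique (others⁺ w-other))) size)
    }
    where
    O? = pair? x y
    σ′ = mix O? idTuple σ
    w = proj₁ non-rep
    w∈O = proj₁ (proj₂ non-rep)
    w-other = proj₁ (proj₂ (proj₂ non-rep))
    w-unique = proj₂ (proj₂ (proj₂ non-rep))
    rep′ : Fin n → Fin n
    rep′ = splice O? id rep
    rep′-in : ∀ {z} → Pair x y z → rep′ z ≡ z
    rep′-in = splice-in O? id rep
    rep′-out : ∀ {z} → ¬ Pair x y z → rep′ z ≡ rep z
    rep′-out = splice-out O? id rep
    rep′-act : ∀ i z → rep′ (act σ′ i z) ≡ rep′ z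
    rep′-act i z with O? z
    ... | yes pz = cong rep′ (trans (act-mix-in O? idTuple σ i pz) (act-idTuple i z))
    ... | no ¬pz = begin
        rep′ (act σ′ i z) ≡⟨ cong rep′ (act-mix-out O? idTuple σ i ¬pz) ⟩
        rep′ (act σ i z)  ≡⟨ rep′-out (¬pz ∘ proj₂ (orbit-invariant i z)) ⟩
        rep (act σ i z)   ≡⟨ rep-act i z ⟩
        rep z             ≡⟨ rep′-out ¬pz ⟨
        rep′ z            ∎
      where open ≡-Reasoning
    rep′-orbit : ∀ z → SameOrbit σ′ (rep′ z) z
    rep′-orbit z with O? z
    ... | yes pz = subst (λ u → SameOrbit σ′ u z) (sym (rep′-in pz)) here
    ... | no ¬pz = subst (λ u → SameOrbit σ′ u z) (sym (rep′-out ¬pz))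
      (SameOrbit-transfer (Invariant-∁ σ orbit-invariant)
        (λ i → act-mix-out O? idTuple σ i) ¬pz (rep-orbit z))
    others′⁺ : ∀ {z} → rep′ z ≢ z → z ∈ without w others
    others′⁺ {z} ne with O? z
    ... | yes pz = contradiction (rep′-in pz) ne
    ... | no ¬pz = ∈-without⁺ w (others⁺ (ne ∘ trans (rep′-out ¬pz))) (λ { refl → ¬pz w∈O })
    others′⁻ : ∀ {z} → z ∈ without w others → rep′ z ≢ z
    others′⁻ {z} z∈ eq with ∈-without⁻ w z∈ | O? z
    ... | z∈o , z≢w | yes pz = z≢w (w-unique pz (others⁻ z∈o))
    ... | z∈o , z≢w | no ¬pz = others⁻ z∈o (trans (sym (rep′-out ¬pz)) eq)

module _ {p n : ℕ} {σ ρ : Tuple p n} {x y : Fin n} (x≢y : x ≢ y) (inv : Invariant (Pair x y) σ)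
  (σ-xy : SameOrbit σ x y) (ρ-comm : IsCommutingTuple ρ) (ρ-x : FixedBy ρ x) (ρ-y : FixedBy ρ y) where

  -- Being fixed by `ρ`, both points represented themselves. Now `x` represents the new orbit, and
  -- `y` is the only new non-representative.
  add-orbit : ∀ {m} → Reps ρ m → Reps (mix (pair? x y) σ ρ) (suc m)
  add-orbit R = record
    { rep       = rep′
    ; rep-act   = rep′-act
    ; rep-orbit = rep′-orbit
    ; others    = y ∷ others
    ; unique    = All.tabulate (λ z∈ y≡z → others⁻ z∈ (subst (λ z → rep z ≡ z) y≡z ry≡y)) ∷ unique
    ; others⁺   = others′⁺
    ; others⁻   = others′⁻
    ; size      = cong suc size
    }
    where
    open Reps R
    O? = pair? x y
    τ = mix O? σ ρ
    ρ-inv : Invariant (Pair x y) ρ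
    ρ-inv = Invariant-fixed ρ ρ-comm ρ-x ρ-y
    rx≡x : rep x ≡ x
    rx≡x = rep-fixed ρ-comm ρ-x
    ry≡y : rep y ≡ y
    ry≡y = rep-fixed ρ-comm ρ-y
    rep′ : Fin n → Fin n
    rep′ = splice O? (const x) rep
    rep′-in : ∀ {z} → Pair x y z → rep′ z ≡ x
    rep′-in = splice-in O? (const x) rep
    rep′-out : ∀ {z} → ¬ Pair x y z → rep′ z ≡ rep z
    rep′-out = splice-out O? (const x) rep
    rep′-act : ∀ i z → rep′ (act τ i z) ≡ rep′ z
    rep′-act i z with O? z
    ... | yes pz = trans (rep′-in (proj₁ (mix-invariant O? σ ρ inv ρ-inv i z) pz)) (sym (rep′-in pz))
    ... | no ¬pz = begin
        rep′ (act τ i z)  ≡⟨ cong rep′ (act-mix-out O? σ ρ i ¬pz) ⟩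
        rep′ (act ρ i z)  ≡⟨ rep′-out (¬pz ∘ proj₂ (ρ-inv i z)) ⟩
        rep (act ρ i z)   ≡⟨ rep-act i z ⟩
        rep z             ≡⟨ rep′-out ¬pz ⟨
        rep′ z            ∎
      where open ≡-Reasoning
    τ-xy : SameOrbit τ x y
    τ-xy = SameOrbit-transfer inv (λ i → act-mix-in O? σ ρ i) (inj₂ refl) σ-xy
    orbit-pair : ∀ {z} → Pair x y z → SameOrbit τ x z
    orbit-pair (inj₁ refl) = here
    orbit-pair (inj₂ refl) = τ-xy
    rep′-orbit : ∀ z → SameOrbit τ (rep′ z) z
    rep′-orbit z with O? z
    ... | yes pz = subst (λ u → SameOrbit τ u z) (sym (rep′-in pz)) (orbit-pair pz)
    ... | no ¬pz = subst (λ u → SameOrbit τ u z) (sym (rep′-out ¬pz))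
      (SameOrbit-transfer (Invariant-∁ ρ ρ-inv) (λ i → act-mix-out O? σ ρ i) ¬pz (rep-orbit z))
    others′⁺ : ∀ {z} → rep′ z ≢ z → z ∈ y ∷ others
    others′⁺ {z} ne with O? z
    ... | yes (inj₁ refl) = contradiction (rep′-in (inj₁ refl)) ne
    ... | yes (inj₂ refl) = here refl
    ... | no ¬pz = there (others⁺ (ne ∘ trans (rep′-out ¬pz)))
    others′⁻ : ∀ {z} → z ∈ y ∷ others → rep′ z ≢ z
    others′⁻ (here refl) eq = x≢y (trans (sym (rep′-in (inj₂ refl))) eq)
    others′⁻ {z} (there z∈) eq with O? z
    ... | yes (inj₁ refl) = others⁻ z∈ rx≡x
    ... | yes (inj₂ refl) = others⁻ z∈ ry≡y
    ... | no ¬pz = others⁻ z∈ (trans (sym (rep′-out ¬pz)) eq)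

-- The support of a tuple with n ∸ m orbits

module _ {p n m : ℕ} {σ : Tuple p n} (R : Reps σ m) where
  open Reps R

  private
    moved-rep? : Decidable (λ z → Moved σ z × rep z ≡ z)
    moved-rep? z = moved? σ z ×-dec (rep z ≟ z)

    rep-partner : ∀ z → rep (partner σ z) ≡ rep z
    rep-partner z = sym (rep-cong (partner-orbit σ z))

    -- Pairing a moved representative with its partner, a non-representative.
    moved-reps-≤ : ∀ {ys} → (∀ {z} → Moved σ z → rep z ≡ z → partner σ z ∈ ys) →
      length (subset moved-rep?) ≤ length ys
    moved-reps-≤ h = injection⇒length-≤ (partner σ) (unique-subset moved-rep?)
      (λ {u} {v} u∈ v∈ eq → trans (sym (proj₂ (∈-subset⁻ moved-rep? u∈)))
        (trans (trans (sym (rep-partner u)) (trans (cong rep eq) (rep-partner v)))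
          (proj₂ (∈-subset⁻ moved-rep? v∈))))
      (λ u∈ → let mu , ru = ∈-subset⁻ moved-rep? u∈ in h mu ru)

    partner-other : ∀ {z} → Moved σ z → rep z ≡ z → partner σ z ∈ others
    partner-other mz rz = others⁺ (λ eq → mz (trans (sym eq) (trans (rep-partner _) rz)))

    supp-≤ : length (supp σ) ≤ length (subset moved-rep?) + length others
    supp-≤ = unique-⊆-++ (unique-subset (moved? σ)) split
      where
      split : ∀ {z} → z ∈ supp σ → z ∈ subset moved-rep? ⊎ z ∈ others
      split {z} z∈ with rep z ≟ z
      ... | yes rz = inj₁ (∈-subset⁺ moved-rep? (∈-subset⁻ (moved? σ) z∈ , rz))
      ... | no ¬rz = inj₂ (others⁺ ¬rz)

  -- At most `m` moved points are non-representatives, and taking partners injects the moved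
  -- representatives into the non-representatives.
  supp-bound : length (supp σ) ≤ m + m
  supp-bound = ≤-trans supp-≤ (+-mono-≤
    (≤-trans (moved-reps-≤ partner-other) (≤-reflexive size)) (≤-reflexive size))

  TwoElementOrbits : Set
  TwoElementOrbits = ∀ {x z} → Moved σ x → rep z ≡ rep x → Pair x (partner σ x) z

  -- If some non-representative `w` is not the partner of its representative, the injection into the
  -- non-representatives misses `w`, and the support is too small. Otherwise a non-representative is
  -- determined by its representative, so no orbit has a third point.
  full-supp⇒TwoElementOrbits : m + m ≤ length (supp σ) → TwoElementOrbits
  full-supp⇒TwoElementOrbits full with all? (λ z → (rep z ≟ z) ⊎-dec (z ≟ partner σ (rep z)))
  ... | no ¬h = contradiction full (<⇒≱ strict)
    where
    bad = ¬∀⟶∃¬ n _ (λ z → (rep z ≟ z) ⊎-dec (z ≟ partner σ (rep z))) ¬h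
    w = proj₁ bad
    w∈ : w ∈ others
    w∈ = others⁺ (proj₂ bad ∘ inj₁)
    avoid : ∀ {z} → Moved σ z → rep z ≡ z → partner σ z ∈ without w others
    avoid {z} mz rz = ∈-without⁺ w (partner-other mz rz)
      (λ eq → proj₂ bad (inj₂ (trans (sym eq)
        (cong (partner σ) (trans (sym rz) (trans (sym (rep-partner z)) (cong rep eq)))))))
    strict : length (supp σ) < m + m
    strict = ≤-trans (s≤s supp-≤) (+-mono-≤
      (≤-trans (s≤s (moved-reps-≤ avoid)) (≤-reflexive (trans (sym (length-without w unique w∈)) size)))
      (≤-reflexive size))
  ... | yes h = two
    where
    two : TwoElementOrbits
    two {x} {z} mx eq with h z | h x
    ... | inj₁ rz | inj₁ rx = inj₁ (trans (sym rz) (trans eq rx))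
    ... | inj₂ z≡ | inj₁ rx = inj₂ (trans z≡ (cong (partner σ) (trans eq rx)))
    ... | inj₂ z≡ | inj₂ x≡ = inj₁ (trans z≡ (trans (cong (partner σ) eq) (sym x≡)))
    -- Here `z` represents the orbit and `x` does not. The partner of `x` is either a
    -- representative, hence `z`, or the partner of `z`, which is `x`; the latter is excluded as `x`
    -- is moved.
    ... | inj₁ rz | inj₂ x≡ with h (partner σ x)
    ...   | inj₁ ry = inj₂ (trans (sym rz) (trans eq (trans (sym (rep-partner x)) ry)))
    ...   | inj₂ y≡ = contradiction (trans y≡ (trans (cong (partner σ) (rep-partner x)) (sym x≡))) mx

-- Pairs of tuples with a small joint support

module _ {A : Set} where

  vectors : List A → (m : ℕ) → List (Vec A m)
  vectors xs zero    = [] ∷ []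
  vectors xs (suc m) = cartesianProductWith _∷_ xs (vectors xs m)

  length-vectors : ∀ xs m → length (vectors xs m) ≡ length xs ^ m
  length-vectors xs zero    = refl
  length-vectors xs (suc m) =
    trans (length-cartesianProductWith _∷_ xs (vectors xs m)) (cong (length xs *_) (length-vectors xs m))

  ∈-vectors : ∀ {xs m} (v : Vec A m) → (∀ i → lookup v i ∈ xs) → v ∈ vectors xs m
  ∈-vectors []      h = here refl
  ∈-vectors (a ∷ v) h = ∈-cartesianProductWith⁺ _∷_ (h zero) (∈-vectors v (h ∘ suc))

  -- Supports of all sizes up to `m` become vectors of one length, which are easy to count; repeated
  -- entries do no harm to an upper bound.
  pad : A → ∀ {m} (xs : List A) → length xs ≤ m → ∃ λ (v : Vec A m) → ∀ {z} → z ∈ xs → z ∈ Vec.toList v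
  pad a []       _         = replicate _ a , λ ()
  pad a (x ∷ xs) (s≤s le) = let v , h = pad a xs le in
    x ∷ v , λ { (here eq) → here eq ; (there z∈) → there (h z∈) }

module _ {n : ℕ} (v : List (Fin n)) where

  -- An overcount suffices: if a point occurs twice, as padding allows, a map may be listed more
  -- than once.
  assignments : List (Fin n) → List (Map n)
  assignments []      = Vec.allFin n ∷ []
  assignments (z ∷ u) = cartesianProductWith (λ w f → f [ z ]≔ w) v (assignments u)

  length-assignments : ∀ u → length (assignments u) ≡ length v ^ length u
  length-assignments []      = refl
  length-assignments (z ∷ u) = trans (length-cartesianProductWith _ v (assignments u))
    (cong (length v *_) (length-assignments u))

  ∈-assignments : ∀ u f → (∀ {z} → z ∈ u → z ∈ v) → (∀ {z} → z ∈ u → app f z ∈ v) →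
    (∀ {z} → z ∉ u → app f z ≡ z) → f ∈ assignments u
  ∈-assignments [] f _ _ off = here (lookup-ext (λ i → trans (off (λ ())) (sym (lookup∘tabulate id i))))
  ∈-assignments (z ∷ u) f u⊆v on off =
    subst (_∈ assignments (z ∷ u)) (trans ([]≔-idempotent f z) ([]≔-lookup f z))
      (∈-cartesianProductWith⁺ (λ w f → f [ z ]≔ w) (on (here refl)) (∈-assignments u g (u⊆v ∘ there) on′ off′))
    where
    -- The reset makes `g` the identity at `z`, as the induction needs when `z` is not in `u`. If
    -- `z` recurs in `u`, the value `z` must lie in `v`, whence the inclusion hypothesis.
    g = f [ z ]≔ z
    on′ : ∀ {t} → t ∈ u → app g t ∈ v
    on′ {t} t∈ with t ≟ z
    ... | yes refl = subst (_∈ v) (sym (lookup∘update t f t)) (u⊆v (here refl))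
    ... | no t≢z   = subst (_∈ v) (sym (lookup∘update′ t≢z f z)) (on (there t∈))
    off′ : ∀ {t} → t ∉ u → app g t ≡ t
    off′ {t} t∉ with t ≟ z
    ... | yes refl = lookup∘update t f t
    ... | no t≢z   = trans (lookup∘update′ t≢z f z)
      (off (λ { (here eq) → t≢z eq ; (there t∈) → t∉ t∈ }))

  confined : ∀ p → List (Tuple p n)
  confined p = vectors (assignments v) p

  -- The maps send moved points to moved points, which lie in `v`, and fix all others; so they map
  -- `v` into itself.
  ∈-confined : ∀ {p} {σ : Tuple p n} → IsCommutingTuple σ → (∀ {z} → Moved σ z → z ∈ v) → σ ∈ confined p
  ∈-confined {σ = σ} comm h = ∈-vectors σ λ i → ∈-assignments v (lookup σ i) id (stay i) (off i)
    where
    stay : ∀ i {z} → z ∈ v → act σ i z ∈ v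
    stay i {z} z∈ with moved? σ z
    ... | yes mz = h (moved-image σ comm i mz)
    ... | no ¬mz = subst (_∈ v) (sym (unmoved⇒fixed σ ¬mz i)) z∈
    off : ∀ i {z} → z ∉ v → act σ i z ≡ z
    off i z∉ = unmoved⇒fixed σ (z∉ ∘ h) i

  length-confined : ∀ p → length (confined p) ≡ (length v ^ length v) ^ p
  length-confined p = trans (length-vectors (assignments v) p) (cong (_^ p) (length-assignments v))

module _ {p n : ℕ} where

  jointly-moved? : (σ ρ : Tuple p n) → Decidable (λ z → Moved σ z ⊎ Moved ρ z)
  jointly-moved? σ ρ z = moved? σ z ⊎-dec moved? ρ z

  joint-supp : Tuple p n → Tuple p n → List (Fin n)
  joint-supp σ ρ = subset (jointly-moved? σ ρ)

pairsConfinedTo : ∀ {p n M} → Vec (Fin n) M → List (Tuple p n × Tuple p n)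
pairsConfinedTo {p} v = cartesianProduct (confined (Vec.toList v) p) (confined (Vec.toList v) p)

-- The vector contains both supports and is then forgotten. A pair may recur for several vectors,
-- which only weakens the upper bound.
confinedPairs : ∀ p n → ℕ → List (Tuple p n × Tuple p n)
confinedPairs p n M = map proj₂ (fibred pairsConfinedTo (vectors (allFin n) M))

length-confinedPairs : ∀ p n M → length (confinedPairs p n M) ≤ n ^ M * ((M ^ M) ^ p * (M ^ M) ^ p)
length-confinedPairs p n M = begin
    length (confinedPairs p n M)                       ≡⟨ length-map proj₂ (fibred pairs (vectors (allFin n) M)) ⟩
    length (fibred pairs (vectors (allFin n) M))       ≤⟨ length-fibred-≤ pairs (vectors (allFin n) M) K (λ {v} _ → ≤-reflexive (length-pairs v)) ⟩
    length (vectors (allFin n) M) * K                  ≡⟨ cong (_* K) (length-vectors (allFin n) M) ⟩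
    length (allFin n) ^ M * K                          ≡⟨ cong (λ k → k ^ M * K) (length-allFin n) ⟩
    n ^ M * K                                          ∎
  where
  open ≤-Reasoning
  K = (M ^ M) ^ p * (M ^ M) ^ p
  pairs : Vec (Fin n) M → List (Tuple p n × Tuple p n)
  pairs = pairsConfinedTo
  length-pairs : ∀ v → length (pairs v) ≡ K
  length-pairs v = trans (length-cartesianProductWith _,_ (confined (Vec.toList v) p) (confined (Vec.toList v) p))
    (cong (λ k → k * k) (trans (length-confined (Vec.toList v) p) (cong (λ k → (k ^ k) ^ p) (length-toList v))))

-- The point of `Fin n` fills up the vector when the joint support has fewer than `M` elements.
∈-confinedPairs : ∀ {p n M} {σ ρ : Tuple p n} → Fin n → IsCommutingTuple σ → IsCommutingTuple ρ →
  length (joint-supp σ ρ) ≤ M → (σ , ρ) ∈ confinedPairs p n M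
∈-confinedPairs {σ = σ} {ρ} z₀ commσ commρ small =
  ∈-map⁺ proj₂ (∈-fibred⁺ _ (∈-vectors v (λ _ → ∈-allFin _))
    (∈-cartesianProduct⁺ (∈-confined (Vec.toList v) commσ (λ mz → cover (∈-subset⁺ (jointly-moved? σ ρ) (inj₁ mz))))
                         (∈-confined (Vec.toList v) commρ (λ mz → cover (∈-subset⁺ (jointly-moved? σ ρ) (inj₂ mz))))))
  where
  v = proj₁ (pad z₀ (joint-supp σ ρ) small)
  cover = proj₂ (pad z₀ (joint-supp σ ρ) small)

-- Pairs with the largest possible joint support

module _ {p n k l : ℕ} {σ ρ : Tuple p n} (R : Reps σ k) (S : Reps ρ l)
  (large : (k + k) + (l + l) ≤ length (joint-supp σ ρ)) where

  private
    joint-split : ∀ {z} → z ∈ joint-supp σ ρ → z ∈ supp σ ⊎ z ∈ supp ρ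
    joint-split z∈ with ∈-subset⁻ (jointly-moved? σ ρ) z∈
    ... | inj₁ mz = inj₁ (∈-subset⁺ (moved? σ) mz)
    ... | inj₂ mz = inj₂ (∈-subset⁺ (moved? ρ) mz)

  large-joint⇒full-supp : k + k ≤ length (supp σ)
  large-joint⇒full-supp = +-cancelʳ-≤ (l + l) _ _ (begin
      (k + k) + (l + l)                  ≤⟨ large ⟩
      length (joint-supp σ ρ)            ≤⟨ unique-⊆-++ (unique-subset (jointly-moved? σ ρ)) joint-split ⟩
      length (supp σ) + length (supp ρ)  ≤⟨ +-monoʳ-≤ (length (supp σ)) (supp-bound S) ⟩
      length (supp σ) + (l + l)          ∎)
    where open ≤-Reasoning

  -- A common moved point is counted in both supports, so the joint support would stay below the sum
  -- of their bounds.
  large-joint⇒disjoint : ∀ {z} → Moved σ z → ¬ Moved ρ z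
  large-joint⇒disjoint {w} σw ρw = <⇒≱ small large
    where
    open ≤-Reasoning
    w∈ρ : w ∈ supp ρ
    w∈ρ = ∈-subset⁺ (moved? ρ) ρw
    split : ∀ {z} → z ∈ joint-supp σ ρ → z ∈ supp σ ⊎ z ∈ without w (supp ρ)
    split {z} z∈ with joint-split z∈ | z ≟ w
    ... | inj₁ z∈σ | _        = inj₁ z∈σ
    ... | inj₂ z∈ρ | yes refl = inj₁ (∈-subset⁺ (moved? σ) σw)
    ... | inj₂ z∈ρ | no z≢w   = inj₂ (∈-without⁺ w z∈ρ z≢w)
    small : length (joint-supp σ ρ) < (k + k) + (l + l)
    small = begin
      suc (length (joint-supp σ ρ))                          ≤⟨ s≤s (unique-⊆-++ (unique-subset (jointly-moved? σ ρ)) split) ⟩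
      suc (length (supp σ) + length (without w (supp ρ)))    ≡⟨ +-suc _ _ ⟨
      length (supp σ) + suc (length (without w (supp ρ)))    ≡⟨ cong (length (supp σ) +_) (length-without w (unique-subset (moved? ρ)) w∈ρ) ⟨
      length (supp σ) + length (supp ρ)                      ≤⟨ +-mono-≤ (supp-bound R) (supp-bound S) ⟩
      (k + k) + (l + l)                                      ∎

-- Moving an orbit from one tuple to another

module _ {p n : ℕ} {P : Pred (Fin n) 0ℓ} (P? : Decidable P) (σ ρ : Tuple p n) where

  -- The glued tuple shows `σ` inside `P`, and the cut tuple shows it outside.
  mix-restores-inside : mix P? (mix P? σ ρ) (mix P? idTuple σ) ≡ σ
  mix-restores-inside = tuple-ext restore
    where
    restore : ∀ i z → act (mix P? (mix P? σ ρ) (mix P? idTuple σ)) i z ≡ act σ i z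
    restore i z with P? z
    ... | yes pz = trans (act-mix-in P? (mix P? σ ρ) (mix P? idTuple σ) i pz) (act-mix-in P? σ ρ i pz)
    ... | no ¬pz = trans (act-mix-out P? (mix P? σ ρ) (mix P? idTuple σ) i ¬pz) (act-mix-out P? idTuple σ i ¬pz)

  -- Erasing the glued part loses nothing of `ρ`, which was the identity there.
  mix-restores-outside : (∀ {z} → P z → FixedBy ρ z) → mix P? idTuple (mix P? σ ρ) ≡ ρ
  mix-restores-outside fixed = tuple-ext restore
    where
    restore : ∀ i z → act (mix P? idTuple (mix P? σ ρ)) i z ≡ act ρ i z
    restore i z with P? z
    ... | yes pz = trans (act-mix-in P? idTuple (mix P? σ ρ) i pz) (trans (act-idTuple i z) (sym (fixed pz i)))
    ... | no ¬pz = trans (act-mix-out P? idTuple (mix P? σ ρ) i ¬pz) (act-mix-out P? σ ρ i ¬pz)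

-- Indexing by the number of non-representatives turns the three orbit counts into `k`, `suc k` and
-- `suc (suc k)`, free of truncated subtraction.
Enumerates : ∀ {p n} → List (Tuple p n) → ℕ → Set
Enumerates L m = ∀ σ → (σ ∈ L → IsCommutingTuple σ × Reps σ m) × (IsCommutingTuple σ × Reps σ m → σ ∈ L)

module _ {p n : ℕ} where

  orbit? : (σ : Tuple p n) (x : Fin n) → Decidable (Pair x (partner σ x))
  orbit? σ x = pair? x (partner σ x)

  -- The point `x` is kept to mark which orbit was moved.
  moveOrbit : (Tuple p n × Tuple p n) × Fin n → (Tuple p n × Tuple p n) × Fin n
  moveOrbit ((σ , ρ) , x) = (mix (orbit? σ x) idTuple σ , mix (orbit? σ x) σ ρ) , x

  partner-mix : ∀ (σ ρ : Tuple p n) x → partner (mix (orbit? σ x) σ ρ) x ≡ partner σ x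
  partner-mix σ ρ x = partner-cong (mix (orbit? σ x) σ ρ) σ x (λ i → act-mix-in (orbit? σ x) σ ρ i (inj₁ refl))

  -- The glued tuple agrees with `σ` at `x`, so it reveals the partner of `x` and thereby the moved
  -- pair. With the pair known, `mix-restores-inside` and `mix-restores-outside` recover `σ` and
  -- `ρ`.
  moveOrbit-injective : ∀ {σ ρ σ′ ρ′ x x′} →
    (∀ {z} → Pair x (partner σ x) z → FixedBy ρ z) → (∀ {z} → Pair x′ (partner σ′ x′) z → FixedBy ρ′ z) →
    moveOrbit ((σ , ρ) , x) ≡ moveOrbit ((σ′ , ρ′) , x′) → ((σ , ρ) , x) ≡ ((σ′ , ρ′) , x′)
  moveOrbit-injective {σ} {ρ} {σ′} {ρ′} {x} {x′} fixed fixed′ eq with ,-injectiveʳ eq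
  ... | refl = cong₂ _,_ (cong₂ _,_ σ≡σ′ ρ≡ρ′) refl
    where
    eq-minus : mix (orbit? σ x) idTuple σ ≡ mix (orbit? σ′ x) idTuple σ′
    eq-minus = ,-injectiveˡ (,-injectiveˡ eq)
    eq-plus : mix (orbit? σ x) σ ρ ≡ mix (orbit? σ′ x) σ′ ρ′
    eq-plus = ,-injectiveʳ (,-injectiveˡ eq)
    y≡y′ : partner σ x ≡ partner σ′ x
    y≡y′ = trans (sym (partner-mix σ ρ x)) (trans (cong (λ τ → partner τ x) eq-plus) (partner-mix σ′ ρ′ x))
    σ≡σ′ : σ ≡ σ′
    σ≡σ′ = begin
      σ
        ≡⟨ mix-restores-inside (orbit? σ x) σ ρ ⟨
      mix (orbit? σ x) (mix (orbit? σ x) σ ρ) (mix (orbit? σ x) idTuple σ)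
        ≡⟨ cong₂ (mix (orbit? σ x)) eq-plus eq-minus ⟩
      mix (orbit? σ x) (mix (orbit? σ′ x) σ′ ρ′) (mix (orbit? σ′ x) idTuple σ′)
        ≡⟨ cong (λ y → mix (pair? x y) (mix (orbit? σ′ x) σ′ ρ′) (mix (orbit? σ′ x) idTuple σ′)) y≡y′ ⟩
      mix (orbit? σ′ x) (mix (orbit? σ′ x) σ′ ρ′) (mix (orbit? σ′ x) idTuple σ′)
        ≡⟨ mix-restores-inside (orbit? σ′ x) σ′ ρ′ ⟩
      σ′ ∎
      where open ≡-Reasoning
    ρ≡ρ′ : ρ ≡ ρ′
    ρ≡ρ′ = begin
      ρ                                                         ≡⟨ mix-restores-outside (orbit? σ x) σ ρ fixed ⟨
      mix (orbit? σ x) idTuple (mix (orbit? σ x) σ ρ)           ≡⟨ cong (mix (orbit? σ x) idTuple) eq-plus ⟩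
      mix (orbit? σ x) idTuple (mix (orbit? σ′ x) σ′ ρ′)        ≡⟨ cong (λ y → mix (pair? x y) idTuple (mix (orbit? σ′ x) σ′ ρ′)) y≡y′ ⟩
      mix (orbit? σ′ x) idTuple (mix (orbit? σ′ x) σ′ ρ′)       ≡⟨ mix-restores-outside (orbit? σ′ x) σ′ ρ′ fixed′ ⟩
      ρ′                                                        ∎
      where open ≡-Reasoning

  module _ {k l : ℕ} {σ ρ : Tuple p n} (σ-comm : IsCommutingTuple σ) (ρ-comm : IsCommutingTuple ρ)
    (R : Reps σ (suc k)) (S : Reps ρ l)
    (large : (suc k + suc k) + (l + l) ≤ length (joint-supp σ ρ)) {x : Fin n} (mx : Moved σ x) where

    private
      y = partner σ x
      x≢y : x ≢ y
      x≢y = mx ∘ sym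
      my : Moved σ y
      my = let i , eq = partner-image σ x mx in subst (Moved σ) (sym eq) (moved-image σ σ-comm i mx)
      same : Reps.rep R y ≡ Reps.rep R x
      same = sym (Reps.rep-cong R (partner-orbit σ x))
      two : ∀ {z} → Reps.rep R z ≡ Reps.rep R x → Pair x y z
      two = full-supp⇒TwoElementOrbits R (large-joint⇒full-supp R S large) mx
      inv : Invariant (Pair x y) σ
      inv = orbit-invariant x≢y R same two

    -- Both points are moved by `σ`, and the two supports are disjoint.
    orbit-fixed : ∀ {z} → Pair x y z → FixedBy ρ z
    orbit-fixed (inj₁ refl) = unmoved⇒fixed ρ (large-joint⇒disjoint R S large mx)
    orbit-fixed (inj₂ refl) = unmoved⇒fixed ρ (large-joint⇒disjoint R S large my)

    minus-orbit : IsCommutingTuple (mix (orbit? σ x) idTuple σ) × Reps (mix (orbit? σ x) idTuple σ) k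
    minus-orbit =
      mix-commuting (orbit? σ x) idTuple σ
        (Invariant-fixed idTuple idTuple-commuting (λ i → act-idTuple i x) (λ i → act-idTuple i y)) inv
        idTuple-commuting σ-comm ,
      remove-orbit x≢y R same two

    plus-orbit : IsCommutingTuple (mix (orbit? σ x) σ ρ) × Reps (mix (orbit? σ x) σ ρ) (suc l)
    plus-orbit =
      mix-commuting (orbit? σ x) σ ρ inv
        (Invariant-fixed ρ ρ-comm (orbit-fixed (inj₁ refl)) (orbit-fixed (inj₂ refl)))
        σ-comm ρ-comm ,
      add-orbit x≢y inv (partner-orbit σ x) ρ-comm (orbit-fixed (inj₁ refl)) (orbit-fixed (inj₂ refl)) S

  -- Counting pairs by the size of their joint support

  module _ {k : ℕ} {La Lb Lc : List (Tuple p n)} (Lb-unique : Unique Lb) (Lc-unique : Unique Lc)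
    (La-enum : Enumerates La (suc k)) (Lb-enum : Enumerates Lb (suc (suc k))) (Lc-enum : Enumerates Lc k) where

    private
      -- The sum of the two support bounds, hence the largest size that a joint support can have.
      bound : ℕ
      bound = (suc (suc k) + suc (suc k)) + (k + k)

      large? : Decidable (λ (pair : Tuple p n × Tuple p n) → bound ≤ length (joint-supp (proj₁ pair) (proj₂ pair)))
      large? (σ , ρ) = bound ≤? length (joint-supp σ ρ)

      all-pairs : List (Tuple p n × Tuple p n)
      all-pairs = cartesianProduct Lb Lc

    large-pairs : List (Tuple p n × Tuple p n)
    large-pairs = filter large? all-pairs

    private
      marked : List ((Tuple p n × Tuple p n) × Fin n)
      marked = fibred (supp ∘ proj₁) large-pairs

      targets : List ((Tuple p n × Tuple p n) × Fin n)
      targets = fibred (supp ∘ proj₂) (cartesianProduct La La)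

      record Large (σ ρ : Tuple p n) : Set where
        field
          σ-comm : IsCommutingTuple σ
          ρ-comm : IsCommutingTuple ρ
          R      : Reps σ (suc (suc k))
          S      : Reps ρ k
          large  : bound ≤ length (joint-supp σ ρ)

      ∈-large : ∀ {σ ρ} → (σ , ρ) ∈ large-pairs → Large σ ρ
      ∈-large {σ} {ρ} ∈large =
        let ∈pairs , large = ∈-filter⁻ large? {xs = all-pairs} ∈large
            σ∈ , ρ∈ = ∈-cartesianProduct⁻ Lb Lc ∈pairs
            σ-comm , R = proj₁ (Lb-enum σ) σ∈
            ρ-comm , S = proj₁ (Lc-enum ρ) ρ∈
        in record { σ-comm = σ-comm ; ρ-comm = ρ-comm ; R = R ; S = S ; large = large }

      ∈-marked : ∀ {σ ρ x} → ((σ , ρ) , x) ∈ marked → Large σ ρ × Moved σ x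
      ∈-marked {σ} {ρ} ∈m = let p , q = ∈-fibred⁻ _ large-pairs ∈m in ∈-large p , ∈-subset⁻ (moved? σ) q

      -- Cutting takes one non-representative from the first tuple and gluing gives one to the
      -- second, so both arrive at `suc k`. The marked point keeps its partner, so the second tuple
      -- moves it.
      moveOrbit-into : ∀ {t} → t ∈ marked → moveOrbit t ∈ targets
      moveOrbit-into {(σ , ρ) , x} ∈m =
        ∈-fibred⁺ _
          (∈-cartesianProduct⁺
            (proj₂ (La-enum _) (minus-orbit σ-comm ρ-comm R S large mx))
            (proj₂ (La-enum _) (plus-orbit σ-comm ρ-comm R S large mx)))
          (∈-subset⁺ (moved? (mix (orbit? σ x) σ ρ)) (mx ∘ trans (sym (partner-mix σ ρ x))))
        where
        open Large (proj₁ (∈-marked ∈m))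
        mx = proj₂ (∈-marked ∈m)

      moveOrbit-inj : InjectiveOn marked moveOrbit
      moveOrbit-inj ∈m ∈m′ = moveOrbit-injective (fixed ∈m) (fixed ∈m′)
        where
        fixed : ∀ {σ ρ x} → ((σ , ρ) , x) ∈ marked → ∀ {z} → Pair x (partner σ x) z → FixedBy ρ z
        fixed ∈m = orbit-fixed σ-comm ρ-comm R S large (proj₂ (∈-marked ∈m))
          where open Large (proj₁ (∈-marked ∈m))

    -- Double counting of the triples (σ , ρ , x) with x a moved point of σ.
    large-pairs-bound : length large-pairs * (suc (suc k) + suc (suc k)) ≤ length La * length La * (suc k + suc k)
    large-pairs-bound = begin
        length large-pairs * (suc (suc k) + suc (suc k))
          ≤⟨ length-fibred-≥ _ large-pairs _ (full ∘ ∈-large) ⟩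
        length marked
          ≤⟨ injection⇒length-≤ moveOrbit
               (unique-fibred _ (Uniq.filter⁺ large? (Uniq.cartesianProduct⁺ Lb-unique Lc-unique)) (λ (σ , _) → unique-subset (moved? σ)))
               moveOrbit-inj moveOrbit-into ⟩
        length targets
          ≤⟨ length-fibred-≤ _ (cartesianProduct La La) _
               (λ {(_ , ρ)} ∈p → supp-bound (proj₂ (proj₁ (La-enum ρ) (proj₂ (∈-cartesianProduct⁻ La La ∈p))))) ⟩
        length (cartesianProduct La La) * (suc k + suc k)
          ≡⟨ cong (_* (suc k + suc k)) (length-cartesianProductWith _,_ La La) ⟩
        length La * length La * (suc k + suc k) ∎
      where
      open ≤-Reasoning
      full : ∀ {pair} → Large (proj₁ pair) (proj₂ pair) → suc (suc k) + suc (suc k) ≤ length (supp (proj₁ pair))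
      full h = large-joint⇒full-supp (Large.R h) (Large.S h) (Large.large h)

    -- A pair that is not large has at most `M` jointly moved points and is therefore among the
    -- confined pairs.
    all-pairs-bound : ∀ {M} → bound ≡ suc M → Fin n →
      length Lb * length Lc ≤ length large-pairs + n ^ M * ((M ^ M) ^ p * (M ^ M) ^ p)
    all-pairs-bound {M} bound≡ z₀ = begin
        length Lb * length Lc
          ≡⟨ length-cartesianProductWith _,_ Lb Lc ⟨
        length all-pairs
          ≤⟨ unique-⊆-++ (Uniq.cartesianProduct⁺ Lb-unique Lc-unique) split ⟩
        length large-pairs + length (confinedPairs p n M)
          ≤⟨ +-monoʳ-≤ (length large-pairs) (length-confinedPairs p n M) ⟩
        length large-pairs + n ^ M * ((M ^ M) ^ p * (M ^ M) ^ p) ∎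
      where
      open ≤-Reasoning
      split : ∀ {t} → t ∈ all-pairs → t ∈ large-pairs ⊎ t ∈ confinedPairs p n M
      split {σ , ρ} ∈p with large? (σ , ρ)
      ... | yes large = inj₁ (∈-filter⁺ large? ∈p large)
      ... | no ¬large = inj₂ (∈-confinedPairs z₀ (proj₁ (proj₁ (Lb-enum σ) σ∈)) (proj₁ (proj₁ (Lc-enum ρ) ρ∈))
              (s≤s⁻¹ (subst (length (joint-supp σ ρ) <_) bound≡ (≰⇒> ¬large))))
        where
        σ∈ = proj₁ (∈-cartesianProduct⁻ Lb Lc ∈p)
        ρ∈ = proj₂ (∈-cartesianProduct⁻ Lb Lc ∈p)

-- Products of disjoint transpositions

module _ {n : ℕ} (x y : Fin n) where

  transpose-left : transpose x y x ≡ y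
  transpose-left rewrite dec-true (x ≟ x) refl = refl

  transpose-right : transpose x y y ≡ x
  transpose-right with y ≟ x
  ... | yes y≡x = y≡x
  ... | no _ rewrite dec-true (y ≟ y) refl = refl

  transpose-other : ∀ {z} → ¬ Pair x y z → transpose x y z ≡ z
  transpose-other {z} h rewrite dec-false (z ≟ x) (h ∘ inj₁) | dec-false (z ≟ y) (h ∘ inj₂) = refl

  -- Repeating one map in every component makes commutation trivial.
  transposeTuple : ∀ {p} → Tuple p n
  transposeTuple = replicate _ (tabulate (transpose x y))

  act-transposeTuple : ∀ {p} (i : Fin p) z → act transposeTuple i z ≡ transpose x y z
  act-transposeTuple i z = trans (cong (λ f → app f z) (lookup-replicate i _)) (lookup∘tabulate _ z)

  transposeTuple-commuting : ∀ {p} → IsCommutingTuple (transposeTuple {p})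
  transposeTuple-commuting = perm , comm
    where
    perm : ∀ i → IsPerm (lookup transposeTuple i)
    perm i {u} {v} eq = begin
        u                                  ≡⟨ transpose-inverse y x ⟨
        transpose y x (transpose x y u)    ≡⟨ cong (transpose y x) (act-transposeTuple i u) ⟨
        transpose y x (act transposeTuple i u) ≡⟨ cong (transpose y x) eq ⟩
        transpose y x (act transposeTuple i v) ≡⟨ cong (transpose y x) (act-transposeTuple i v) ⟩
        transpose y x (transpose x y v)    ≡⟨ transpose-inverse y x ⟩
        v                                  ∎
      where open ≡-Reasoning
    same : ∀ i j z → act transposeTuple i z ≡ act transposeTuple j z
    same i j z = trans (act-transposeTuple i z) (sym (act-transposeTuple j z))
    comm : ∀ i j z → act transposeTuple i (act transposeTuple j z) ≡ act transposeTuple j (act transposeTuple i z)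
    comm i j z = trans (same i j _) (cong (act transposeTuple j) (same j i z))

  transposeTuple-invariant : ∀ {p} → Invariant (Pair x y) (transposeTuple {p})
  transposeTuple-invariant i z = stay , leave
    where
    stay : Pair x y z → Pair x y (act transposeTuple i z)
    stay (inj₁ refl) = inj₂ (trans (act-transposeTuple i x) transpose-left)
    stay (inj₂ refl) = inj₁ (trans (act-transposeTuple i y) transpose-right)
    leave : Pair x y (act transposeTuple i z) → Pair x y z
    leave h with pair? x y z
    ... | yes pz = pz
    ... | no ¬pz = subst (Pair x y) (trans (act-transposeTuple i z) (transpose-other ¬pz)) h

  transposeTuple-orbit : ∀ {p} → SameOrbit (transposeTuple {suc p}) x y
  transposeTuple-orbit {p} = subst (SameOrbit transposeTuple x)
    (trans (act-transposeTuple {suc p} zero x) transpose-left) (fwd zero here)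

idTuple-Reps : ∀ {p n} → Reps (idTuple {p} {n}) 0
idTuple-Reps = record
  { rep = id ; rep-act = act-idTuple ; rep-orbit = λ _ → here
  ; others = [] ; unique = [] ; others⁺ = λ ne → contradiction refl ne ; others⁻ = λ () ; size = refl }

module _ (p n m : ℕ) where

  record Family (k : ℕ) : Set where
    field
      list      : List (Tuple (suc p) n)
      unique    : Unique list
      commuting : ∀ {σ} → σ ∈ list → IsCommutingTuple σ
      reps      : ∀ {σ} → σ ∈ list → Reps σ k
      -- The points from `k * (m + m)` on remain free for the next transposition, which keeps the
      -- induction going.
      fixed     : ∀ {σ} → σ ∈ list → ∀ {z} → k * (m + m) ≤ toℕ z → FixedBy σ z
      size      : length list ≡ (m * m) ^ k

  -- Each transposition swaps a point of a fresh block of m points with one of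
  -- the next block; as blocks are not reused, different choices yield
  -- different tuples.
  family : ∀ k → k * (m + m) ≤ n → Family k
  family zero _ = record
    { list      = idTuple ∷ []
    ; unique    = All.[] ∷ []
    ; commuting = λ { (here refl) → idTuple-commuting }
    ; reps      = λ { (here refl) → idTuple-Reps }
    ; fixed     = λ { (here refl) _ i → act-idTuple i _ }
    ; size      = refl
    }
  family (suc k) le = record
    { list      = map extend choices
    ; unique    = unique-map extend extend-inj
        (Uniq.cartesianProduct⁺ F.unique (Uniq.cartesianProduct⁺ (Uniq.allFin⁺ m) (Uniq.allFin⁺ m)))
    ; commuting = λ τ∈ → from-extend {IsCommutingTuple} extend-commuting τ∈
    ; reps      = λ τ∈ → from-extend {λ τ → Reps τ (suc k)} extend-reps τ∈
    ; fixed     = λ τ∈ → from-extend {λ τ → ∀ {z} → suc k * (m + m) ≤ toℕ z → FixedBy τ z} extend-fixed τ∈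
    ; size      = size
    }
    where
    s = k * (m + m)
    module F = Family (family k (≤-trans (m≤n+m s (m + m)) le))

    X<n : ∀ (u : Fin m) → s + toℕ u < n
    X<n u = begin-strict
        s + toℕ u   <⟨ +-monoʳ-< s (toℕ<n u) ⟩
        s + m       ≤⟨ +-monoʳ-≤ s (m≤m+n m m) ⟩
        s + (m + m) ≡⟨ +-comm s (m + m) ⟩
        (m + m) + s ≤⟨ le ⟩
        n           ∎
      where open ≤-Reasoning
    Y<n : ∀ (v : Fin m) → s + (m + toℕ v) < n
    Y<n v = begin-strict
        s + (m + toℕ v) <⟨ +-monoʳ-< s (+-monoʳ-< m (toℕ<n v)) ⟩
        s + (m + m)     ≡⟨ +-comm s (m + m) ⟩
        (m + m) + s     ≤⟨ le ⟩
        n               ∎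
      where open ≤-Reasoning
    -- `X` runs through the first `m` points that are still free, and `Y` through the next `m`.
    X Y : Fin m → Fin n
    X u = fromℕ< (X<n u)
    Y v = fromℕ< (Y<n v)
    X-val : ∀ u → toℕ (X u) ≡ s + toℕ u
    X-val u = toℕ-fromℕ< (X<n u)
    Y-val : ∀ v → toℕ (Y v) ≡ s + (m + toℕ v)
    Y-val v = toℕ-fromℕ< (Y<n v)
    X<Y : ∀ u v → toℕ (X u) < toℕ (Y v)
    X<Y u v = subst₂ _<_ (sym (X-val u)) (sym (Y-val v))
      (+-monoʳ-< s (<-≤-trans (toℕ<n u) (m≤m+n m (toℕ v))))
    X≢Y : ∀ u v → X u ≢ Y v
    X≢Y u v eq = <⇒≢ (X<Y u v) (cong toℕ eq)
    X-injective : ∀ {u u′} → X u ≡ X u′ → u ≡ u′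
    X-injective {u} {u′} eq = toℕ-injective (+-cancelˡ-≡ s _ _
      (trans (sym (X-val u)) (trans (cong toℕ eq) (X-val u′))))
    Y-injective : ∀ {v v′} → Y v ≡ Y v′ → v ≡ v′
    Y-injective {v} {v′} eq = toℕ-injective (+-cancelˡ-≡ m _ _ (+-cancelˡ-≡ s _ _
      (trans (sym (Y-val v)) (trans (cong toℕ eq) (Y-val v′)))))

    Choice : Set
    Choice = Tuple (suc p) n × (Fin m × Fin m)
    choices : List Choice
    choices = cartesianProduct F.list (cartesianProduct (allFin m) (allFin m))
    extend : Choice → Tuple (suc p) n
    extend (σ , u , v) = mix (pair? (X u) (Y v)) (transposeTuple (X u) (Y v)) σ

    ∈F : ∀ {σ u v} → (σ , u , v) ∈ choices → σ ∈ F.list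
    ∈F = proj₁ ∘ ∈-cartesianProduct⁻ F.list (cartesianProduct (allFin m) (allFin m))
    fix-X : ∀ {σ} → σ ∈ F.list → ∀ u → FixedBy σ (X u)
    fix-X σ∈ u = F.fixed σ∈ (subst (s ≤_) (sym (X-val u)) (m≤m+n s _))
    fix-Y : ∀ {σ} → σ ∈ F.list → ∀ v → FixedBy σ (Y v)
    fix-Y σ∈ v = F.fixed σ∈ (subst (s ≤_) (sym (Y-val v)) (m≤m+n s _))

    from-extend : ∀ {Q : Tuple (suc p) n → Set} → (∀ {σ u v} → σ ∈ F.list → Q (extend (σ , u , v))) →
      ∀ {τ} → τ ∈ map extend choices → Q τ
    from-extend h τ∈ with ∈-map⁻ extend τ∈
    ... | _ , c∈ , refl = h (∈F c∈)

    extend-commuting : ∀ {σ u v} → σ ∈ F.list → IsCommutingTuple (extend (σ , u , v))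
    extend-commuting {σ} {u} {v} σ∈ = mix-commuting (pair? (X u) (Y v)) (transposeTuple (X u) (Y v)) σ
      (transposeTuple-invariant (X u) (Y v)) (Invariant-fixed σ (F.commuting σ∈) (fix-X σ∈ u) (fix-Y σ∈ v))
      (transposeTuple-commuting (X u) (Y v)) (F.commuting σ∈)

    extend-reps : ∀ {σ u v} → σ ∈ F.list → Reps (extend (σ , u , v)) (suc k)
    extend-reps {σ} {u} {v} σ∈ = add-orbit (X≢Y u v) (transposeTuple-invariant (X u) (Y v))
      (transposeTuple-orbit (X u) (Y v)) (F.commuting σ∈) (fix-X σ∈ u) (fix-Y σ∈ v) (F.reps σ∈)

    extend-fixed : ∀ {σ u v} → σ ∈ F.list → ∀ {z} → suc k * (m + m) ≤ toℕ z → FixedBy (extend (σ , u , v)) z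
    extend-fixed {σ} {u} {v} σ∈ {z} le′ i = trans
      (act-mix-out (pair? (X u) (Y v)) (transposeTuple (X u) (Y v)) σ i
        (λ { (inj₁ refl) → <⇒≢ (<-trans (X<Y u v) Y<z) refl ; (inj₂ refl) → <⇒≢ Y<z refl }))
      (F.fixed σ∈ (≤-trans (m≤n+m s (m + m)) le′) i)
      where
      Y<z : toℕ (Y v) < toℕ z
      Y<z = <-≤-trans (subst₂ _<_ (sym (Y-val v)) (+-comm s (m + m)) (+-monoʳ-< s (+-monoʳ-< m (toℕ<n v)))) le′

    extend-at-X : ∀ σ u v → act (extend (σ , u , v)) zero (X u) ≡ Y v
    extend-at-X σ u v = trans
      (act-mix-in (pair? (X u) (Y v)) (transposeTuple (X u) (Y v)) σ zero (inj₁ refl))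
      (trans (act-transposeTuple (X u) (Y v) {suc p} zero (X u)) (transpose-left (X u) (Y v)))

    extend-at-other : ∀ {σ u v} → σ ∈ F.list → ∀ {w} → w ≢ u → act (extend (σ , u , v)) zero (X w) ≡ X w
    extend-at-other {σ} {u} {v} σ∈ {w} w≢u = trans
      (act-mix-out (pair? (X u) (Y v)) (transposeTuple (X u) (Y v)) σ zero
        [ w≢u ∘ X-injective , X≢Y w v ]′)
      (fix-X σ∈ w zero)

    -- The first map moves `X u` and no other point of its block, which determines `u`. The image of
    -- `X u` gives `v`, and erasing the transposition gives back `σ`.
    extend-inj : InjectiveOn choices extend
    extend-inj {σ , u , v} {σ′ , u′ , v′} c∈ c∈′ eq with u ≟ u′
    ... | no u≢u′ = contradiction
      (trans (sym (extend-at-other (∈F c∈′) u≢u′)) (trans (cong (λ τ → act τ zero (X u)) (sym eq)) (extend-at-X σ u v)))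
      (X≢Y u v)
    ... | yes refl with Y-injective (trans (sym (extend-at-X σ u v)) (trans (cong (λ τ → act τ zero (X u)) eq) (extend-at-X σ′ u v′)))
    ...   | refl = cong (_, u , v) (begin
        σ                           ≡⟨ mix-restores-outside O? T σ (still (∈F c∈)) ⟨
        mix O? idTuple (mix O? T σ) ≡⟨ cong (mix O? idTuple) eq ⟩
        mix O? idTuple (mix O? T σ′) ≡⟨ mix-restores-outside O? T σ′ (still (∈F c∈′)) ⟩
        σ′                          ∎)
      where
      open ≡-Reasoning
      O? = pair? (X u) (Y v)
      T = transposeTuple (X u) (Y v)
      still : ∀ {σ} → σ ∈ F.list → ∀ {z} → Pair (X u) (Y v) z → FixedBy σ z
      still σ∈ (inj₁ refl) = fix-X σ∈ u
      still σ∈ (inj₂ refl) = fix-Y σ∈ v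

    size : length (map extend choices) ≡ (m * m) ^ suc k
    size = begin
        length (map extend choices)
          ≡⟨ length-map extend choices ⟩
        length choices
          ≡⟨ length-cartesianProductWith _,_ F.list (cartesianProduct (allFin m) (allFin m)) ⟩
        length F.list * length (cartesianProduct (allFin m) (allFin m))
          ≡⟨ cong₂ _*_ F.size (trans (length-cartesianProductWith _,_ (allFin m) (allFin m)) (cong (λ l → l * l) (length-allFin m))) ⟩
        (m * m) ^ k * (m * m)
          ≡⟨ *-comm ((m * m) ^ k) (m * m) ⟩
        (m * m) ^ suc k ∎
      where open ≡-Reasoning

  lower-bound : ∀ {k L} → k * (m + m) ≤ n → Enumerates L k → (m * m) ^ k ≤ length L
  lower-bound {k} {L} le enum = subst (_≤ length L) F.size
    (unique-⊆⇒length-≤ F.unique (λ {σ} σ∈ → proj₂ (enum σ) (F.commuting σ∈ , F.reps σ∈)))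
    where module F = Family (family k le)

-- The inequality for large n

double-cancel-≤ : ∀ {u v} → u + u ≤ v + v → u ≤ v
double-cancel-≤ le = ≮⇒≥ (λ v<u → <⇒≱ (+-mono-< v<u v<u) le)

-- Good pairs make up at most `k` parts of `s` out of `suc k`, and bad pairs at most one part.
-- Everything is multiplied by `suc k` to avoid fractions.
combine : ∀ {t good bad s k} →
  good * (suc k + suc k) ≤ s * (k + k) → t ≤ good + bad → bad * suc k ≤ s → t ≤ s
combine {t} {good} {bad} {s} {k} h-good h-t h-bad = *-cancelʳ-≤ t s (suc k) (begin
    t * suc k                     ≤⟨ *-monoˡ-≤ (suc k) h-t ⟩
    (good + bad) * suc k          ≡⟨ *-distribʳ-+ (suc k) good bad ⟩
    good * suc k + bad * suc k    ≤⟨ +-mono-≤ good-≤ h-bad ⟩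
    s * k + s                     ≡⟨ +-comm (s * k) s ⟩
    s + s * k                     ≡⟨ *-suc s k ⟨
    s * suc k                     ∎)
  where
  open ≤-Reasoning
  good-≤ : good * suc k ≤ s * k
  good-≤ = double-cancel-≤ (subst₂ _≤_ (*-distribˡ-+ good (suc k) (suc k)) (*-distribˡ-+ s k k) h-good)

^-distribʳ-* : ∀ m n k → (m * n) ^ k ≡ m ^ k * n ^ k
^-distribʳ-* m n zero    = refl
^-distribʳ-* m n (suc k) =
  trans (cong ((m * n) *_) (^-distribʳ-* m n k)) ([m*n]*[o*p]≡[m*o]*[n*p] m n (m ^ k) (n ^ k))

square-power : ∀ m k → (m * m) ^ k * (m * m) ^ k ≡ m ^ ((k + k) + (k + k))
square-power m k = begin
    (m * m) ^ k * (m * m) ^ k    ≡⟨ cong (λ t → t * t) (trans (^-distribʳ-* m m k) (sym (^-distribˡ-+-* m k k))) ⟩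
    m ^ (k + k) * m ^ (k + k)    ≡⟨ ^-distribˡ-+-* m (k + k) (k + k) ⟨
    m ^ ((k + k) + (k + k))      ∎
  where open ≡-Reasoning

-- Passing from `n` to `m` costs the factor `q ^ M`; one spare factor `m` absorbs it together with
-- `C`.
power-bound : ∀ {n m M} q C → n ≤ q * m → q ^ M * C ≤ m → n ^ M * C ≤ m ^ suc M
power-bound {n} {m} {M} q C n≤ C≤ = begin
    n ^ M * C               ≤⟨ *-monoˡ-≤ C (^-monoˡ-≤ M n≤) ⟩
    (q * m) ^ M * C         ≡⟨ cong (_* C) (trans (^-distribʳ-* q m M) (*-comm (q ^ M) (m ^ M))) ⟩
    m ^ M * q ^ M * C       ≡⟨ *-assoc (m ^ M) (q ^ M) C ⟩
    m ^ M * (q ^ M * C)     ≤⟨ *-monoʳ-≤ (m ^ M) C≤ ⟩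
    m ^ M * m               ≡⟨ *-comm (m ^ M) m ⟩
    m ^ suc M               ∎
  where open ≤-Reasoning

A≡⇒Enumerates : ∀ {p n k m} → m ≤ n → k ≡ n ∸ m → ∀ {L : List (Tuple p n)} →
  (∀ σ → (σ ∈ L) ⇔ InA p n k σ) → Enumerates L m
A≡⇒Enumerates m≤n refl h σ =
  (λ σ∈ → let comm , orbits = Equivalence.to (h σ) σ∈ in comm , HasOrbits⇒Reps m≤n orbits) ,
  (λ (comm , R) → Equivalence.from (h σ) (comm , Reps⇒HasOrbits R))

theorem1p1 : ∀ (p α : ℕ) → 2 ≤ p → 1 ≤ α →
    ∃ λ (N : ℕ) → ∀ (n : ℕ) → N ≤ n →
    ∀ (a b c : ℕ) →
    A≡ p n (n ∸ α) a → A≡ p n (n ∸ α ∸ 1) b → A≡ p n (n ∸ α + 1) c →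
    b * c ≤ a * a
theorem1p1 zero _ () _
theorem1p1 _ zero _ ()
-- The threshold makes the block size `m = n / d` exceed `W`. The divisor `d = α + α` leaves room
-- for `α` transpositions with two blocks each.
theorem1p1 p@(suc p-1) α@(suc k) _ _ = suc W * d , main
  where
  d = α + α
  -- This is `4 * α` less one, the largest joint support of a bad pair.
  M = (k + suc α) + suc (k + k)
  -- The factor `suc α` keeps the bad pairs within the single part that `combine` allots to them.
  C = ((M ^ M) ^ p * (M ^ M) ^ p) * suc α
  -- The base comes from `n ≤ (d + d) * m`: the remainder of `n` modulo `d` is at most `m * d`
  -- because `m` is positive.
  W = (d + d) ^ M * C

  bound≡ : (suc α + suc α) + (k + k) ≡ suc M
  bound≡ = cong suc (sym (+-suc (k + suc α) (k + k)))

  4α≡ : (α + α) + (α + α) ≡ suc M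
  4α≡ = cong suc (begin
      k + α + (α + α)              ≡⟨ cong (k + α +_) (cong suc (+-suc k k)) ⟩
      k + α + suc (suc (k + k))    ≡⟨ +-suc (k + α) _ ⟩
      suc (k + α) + suc (k + k)    ≡⟨ cong (_+ suc (k + k)) (+-suc k α) ⟨
      M                            ∎)
    where open ≡-Reasoning

  main : ∀ n → suc W * d ≤ n → ∀ a b c →
    A≡ p n (n ∸ α) a → A≡ p n (n ∸ α ∸ 1) b → A≡ p n (n ∸ α + 1) c → b * c ≤ a * a
  main n N≤n a b c (La , ua , ea , refl) (Lb , ub , eb , refl) (Lc , uc , ec , refl) =
    combine {good = length (large-pairs ub uc enum-a enum-b enum-c)} {k = α}
            (large-pairs-bound ub uc enum-a enum-b enum-c)
            (all-pairs-bound ub uc enum-a enum-b enum-c bound≡ (fromℕ< (≤-trans (s≤s z≤n) 1+α≤n)))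
            bad-≤
    where
    open ≤-Reasoning
    m = n / d
    W<m : suc W ≤ m
    W<m = subst (_≤ m) (m*n/n≡m (suc W) d) (/-monoˡ-≤ d N≤n)
    1+α≤n : suc α ≤ n
    1+α≤n = begin
      suc α       ≤⟨ +-monoˡ-≤ α (s≤s z≤n) ⟩
      α + α       ≤⟨ m≤m+n d (W * d) ⟩
      suc W * d   ≤⟨ N≤n ⟩
      n           ∎
    α≤n : α ≤ n
    α≤n = <⇒≤ 1+α≤n
    k≤n : k ≤ n
    k≤n = <⇒≤ α≤n
    enum-a : Enumerates La α
    enum-a = A≡⇒Enumerates α≤n refl ea
    enum-b : Enumerates Lb (suc α)
    enum-b = A≡⇒Enumerates 1+α≤n (trans (∸-+-assoc n α 1) (cong (n ∸_) (+-comm α 1))) eb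
    enum-c : Enumerates Lc k
    enum-c = A≡⇒Enumerates k≤n
      (trans (+-comm (n ∸ α) 1) (sym (+-∸-assoc 1 α≤n))) ec
    n≤ : n ≤ (d + d) * m
    n≤ = begin
      n               ≡⟨ m≡m%n+[m/n]*n n d ⟩
      n % d + m * d   ≤⟨ +-monoˡ-≤ (m * d) (<⇒≤ (m%n<n n d)) ⟩
      d + m * d       ≤⟨ +-monoˡ-≤ (m * d) (≤-trans (m≤m+n d (W * d)) (*-monoˡ-≤ d W<m)) ⟩
      m * d + m * d   ≡⟨ *-distribˡ-+ m d d ⟨
      m * (d + d)     ≡⟨ *-comm m (d + d) ⟩
      (d + d) * m     ∎
    blocks-fit : α * (m + m) ≤ n
    blocks-fit = begin
      α * (m + m)    ≡⟨ *-distribˡ-+ α m m ⟩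
      α * m + α * m  ≡⟨ *-distribʳ-+ m α α ⟨
      d * m          ≡⟨ *-comm d m ⟩
      m * d          ≤⟨ m/n*n≤m n d ⟩
      n              ∎
    a-≥ : (m * m) ^ α ≤ length La
    a-≥ = lower-bound p-1 n m blocks-fit enum-a
    bad-≤ : n ^ M * ((M ^ M) ^ p * (M ^ M) ^ p) * suc α ≤ length La * length La
    bad-≤ = begin
      n ^ M * ((M ^ M) ^ p * (M ^ M) ^ p) * suc α ≡⟨ *-assoc (n ^ M) _ (suc α) ⟩
      n ^ M * C                                   ≤⟨ power-bound {M = M} (d + d) C n≤ (<⇒≤ W<m) ⟩
      m ^ suc M                                   ≡⟨ cong (m ^_) 4α≡ ⟨
      m ^ ((α + α) + (α + α))                     ≡⟨ square-power m α ⟨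
      (m * m) ^ α * (m * m) ^ α                   ≤⟨ *-mono-≤ a-≥ a-≥ ⟩
      length La * length La                       ∎
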